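{- Let $T$ be a tree with vertex set $\{1,\ldots,n\}$, edge set $\{e_1,\ldots,e_{n-1}\}$ and nonzero real edge weights $w_1,\ldots,w_{n-1}$. Suppose $T$ has no vertex of degree $2$. Then the squared distance matrix $\Delta$ of $T$ satisfies $$\det\Delta=(-1)^{n-1}\frac{4^{n-2}}{2}\prod_{i=1}^n\tau_i\prod_{i=1}^{n-1}w_i^2\sum_{i=1}^n\frac{\hat\delta_i^2}{\tau_i}.$$
   Context: For vertices $i\neq j$, $d(i,j)$ is the sum of the weights of the edges on the unique $ij$-path, $d(i,i)=0$, and $\Delta$ is the $n\times n$ matrix with $(i,j)$-entry $d(i,j)^2$. $\tau_i=2-\delta_i$ where $\delta_i$ is the degree of vertex $i$ (nonzero here since no vertex has degree $2$), and $\hat\delta_i$ is the sum of the weights of the edges incident to vertex $i$. -}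

module Defs where

open import Level using (Level; _⊔_) renaming (suc to lsuc)
open import Data.Nat as ℕ using (ℕ; zero; suc)
open import Data.Fin using (Fin; zero; suc; toℕ; punchIn; _≟_)
open import Data.Product using (Σ; _×_; _,_; proj₁; proj₂)
open import Data.Sum using (_⊎_)
open import Data.List using (List; []; _∷_)
open import Data.List.Relation.Unary.Unique.Propositional using (Unique)
open import Relation.Nullary using (¬_; yes; no)
open import Relation.Binary.PropositionalEquality using (_≡_)
open import Algebra.Bundles using (CommutativeRing)

record Field (c ℓ : Level) : Set (lsuc (c ⊔ ℓ)) where
  field
    commutativeRing : CommutativeRing c ℓ
  open CommutativeRing commutativeRing public
    using (Carrier; _≈_; _+_; _*_; -_; _-_; 0#; 1#)
  field
    _⁻¹      : Carrier → Carrier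
    inverseʳ : ∀ x → ¬ (x ≈ 0#) → (x * (x ⁻¹)) ≈ 1#

  ι : ℕ → Carrier
  ι zero    = 0#
  ι (suc k) = 1# + ι k

  _^_ : Carrier → ℕ → Carrier
  x ^ zero  = 1#
  x ^ suc k = x * (x ^ k)

  sumF : ∀ {k} → (Fin k → Carrier) → Carrier
  sumF {zero}  f = 0#
  sumF {suc k} f = f zero + sumF (λ i → f (suc i))

  prodF : ∀ {k} → (Fin k → Carrier) → Carrier
  prodF {zero}  f = 1#
  prodF {suc k} f = f zero * prodF (λ i → f (suc i))

  det : ∀ {k} → (Fin k → Fin k → Carrier) → Carrier
  det {zero}  M = 1#
  det {suc k} M =
    sumF (λ j → ((- 1#) ^ toℕ j) * (M zero j * det (λ r c → M (suc r) (punchIn j c))))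

record CharZeroField (c ℓ : Level) : Set (lsuc (c ⊔ ℓ)) where
  field
    fld      : Field c ℓ
  open Field fld public
  field
    charZero : ∀ k → ¬ (ι (suc k) ≈ 0#)

-- Graphs on vertex set Fin n with edge set Fin m; edge e has end
-- vertices ends e (orientation irrelevant).

module Graph {n m : ℕ} (ends : Fin m → Fin n × Fin n) where

  Joins : Fin m → Fin n → Fin n → Set
  Joins e i k = (ends e ≡ (i , k)) ⊎ (ends e ≡ (k , i))

  data Walk : Fin n → Fin n → Set where
    []   : ∀ {i} → Walk i i
    step : ∀ {i k j} (e : Fin m) → Joins e i k → Walk k j → Walk i j

  vertices : ∀ {i j} → Walk i j → List (Fin n)
  vertices {i} []           = i ∷ []
  vertices {i} (step e _ p) = i ∷ vertices p

  edgesOf : ∀ {i j} → Walk i j → List (Fin m)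
  edgesOf []           = []
  edgesOf (step e _ p) = e ∷ edgesOf p

  Path : Fin n → Fin n → Set
  Path i j = Σ (Walk i j) (λ p → Unique (vertices p))

  record IsTree : Set where
    field
      noLoops : ∀ e → ¬ (proj₁ (ends e) ≡ proj₂ (ends e))
      path    : ∀ i j → Path i j
      unique  : ∀ i j (p q : Path i j) → edgesOf (proj₁ p) ≡ edgesOf (proj₁ q)

  incident : Fin n → Fin m → Set
  incident i e = (proj₁ (ends e) ≡ i) ⊎ (proj₂ (ends e) ≡ i)

  degree : Fin n → ℕ
  degree i = go (λ e → e)
    where
    go : ∀ {k} → (Fin k → Fin m) → ℕ
    go {zero}  f = 0
    go {suc k} f with proj₁ (ends (f zero)) ≟ i | proj₂ (ends (f zero)) ≟ i
    ... | no _  | no _ = go (λ x → f (suc x))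
    ... | _     | _    = suc (go (λ x → f (suc x)))

  module Weighted {c ℓ} (F : CharZeroField c ℓ) (w : Fin m → CharZeroField.Carrier F) where
    open CharZeroField F

    weight : ∀ {i j} → Walk i j → Carrier
    weight []           = 0#
    weight (step e _ p) = w e + weight p

    wdegree : Fin n → Carrier
    wdegree i = sumF (λ e → inc e)
      where
      inc : Fin m → Carrier
      inc e with proj₁ (ends e) ≟ i | proj₂ (ends e) ≟ i
      ... | no _ | no _ = 0#
      ... | _    | _    = w e

    τ : Fin n → Carrier
    τ i = ι 2 - ι (degree i)

    -- d(i,j): weight of the unique i–j path (d(i,i) = 0 since the only
    -- path from i to i is the trivial one)
    dist : IsTree → Fin n → Fin n → Carrier
    dist T i j = weight (proj₁ (IsTree.path T i j))

    Δ : IsTree → Fin n → Fin n → Carrier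
    Δ T i j = dist T i j * dist T i j

{-# OPTIONS --safe #-}

-- Row and column operations along the edges of a rooted tree turn the squared
-- distance matrix into W B W, where W is the diagonal matrix of the edge weights
-- (with a 1 for the root) and B involves only the signs telling on which side of an
-- edge the other edges lie, together with one row and column of distances to the root.
-- The identities D L = 1 τᵀ - 2 I and Δ L = 2 D τ - 1 ŵᵀ for the weighted Laplacian L,
-- stated for B so that no inverse weights occur, factor B further until only an arrow
-- matrix -4 I + a ρᵀ + ρ bᵀ is left (ρ is the indicator of the root), and its
-- determinant is (-4)ⁿ⁻¹ times the sum of ŵ² / τ up to a constant. All these identities
-- are proved by attaching one leaf after the other; they stay polynomial, because the
-- intermediate trees may have vertices of degree two. Multiplicativity of the
-- determinant under linear maps of rows comes from the uniqueness of alternating forms.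

module Submission where

open import Defs
open import Level using (Level; _⊔_)
open import Algebra.Bundles using (CommutativeRing)
import Algebra.Properties.AbelianGroup as AbelianGroupProperties
import Algebra.Properties.CommutativeMonoid.Sum as CommutativeMonoidSum
import Algebra.Properties.Ring as RingProperties
import Algebra.Solver.Ring as RingSolver
open import Algebra.Solver.Ring.AlmostCommutativeRing using (fromCommutativeRing; _-Raw-AlmostCommutative⟶_)
open import Data.Fin using (Fin; zero; suc; toℕ; fromℕ; punchIn; _≟_)
open import Data.Fin.Permutation using (Permutation; permutation)
open import Data.Fin.Properties using (any?; injective⇒≤; punchOut-injective; ¬∀⟶∃¬)
open import Data.Integer as ℤ using (ℤ; +_; -[1+_])
import Data.Integer.Properties as ℤ
open import Data.List as List using (List)
open import Data.List.Properties using (∷-injective)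
open import Data.List.Relation.Unary.All as All using (All)
import Data.List.Relation.Unary.All.Properties as All
open import Data.List.Relation.Unary.Unique.Propositional using (Unique)
open import Data.Maybe using (Maybe; just; nothing)
open import Data.Nat as ℕ using (ℕ; zero; suc)
import Data.Nat.Properties as ℕ
open import Data.Product using (Σ; ∃; _×_; _,_; proj₁; proj₂)
open import Data.Sum using ([_,_]; inj₁; inj₂)
open import Data.Unit.Polymorphic using (⊤)
import Data.Vec.Functional as Vector
open import Function using (_∘_)
open import Function.Definitions using (Injective)
open import Relation.Binary.PropositionalEquality as ≡ using (_≡_; _≢_)
import Relation.Binary.Reasoning.Setoid as SetoidReasoning
open import Relation.Nullary using (¬_; yes; no; contradiction)

-- The identities live on trees given as data, where induction on the newest leaf is available,
-- whereas the theorem speaks of a graph whose tree property is existence and uniqueness of paths.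
-- An exploration of the graph bridges the two: it rebuilds the graph leaf by leaf and yields
-- injections on vertices and on edges, which are bijections once every vertex is reached. The
-- vertex bijection permutes rows and columns of `Δ` alike, so its sign enters squared.
--
-- The denominator 8 has a definite origin: two of the column operations are not unimodular, one
-- having determinant 2 and the other 4. Hence the identity proved first is `8 det Δ = (-4)^(n-1)`
-- times the products and the sum, and the division by 8 comes only at the very end. Likewise the
-- quotients of `ŵ` by `τ` enter the tree identities only as a row `z` assumed to satisfy `z τ = ŵ`;
-- the row is supplied for the finished tree, where the degree hypothesis makes `τ` invertible.

-- A ring solver with integer coefficients.

module _ {c ℓ} (R : CommutativeRing c ℓ) where
  open CommutativeRing R
  open RingProperties ring using (-‿distribʳ-*; -0#≈0#; -‿involutive)
  open AbelianGroupProperties +-abelianGroup using (⁻¹-∙-comm)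
  open SetoidReasoning setoid

  private
    ι : ℕ → Carrier
    ι zero    = 0#
    ι (suc k) = 1# + ι k

    ι-+ : ∀ m n → ι (m ℕ.+ n) ≈ ι m + ι n
    ι-+ zero    n = sym (+-identityˡ _)
    ι-+ (suc m) n = trans (+-congˡ (ι-+ m n)) (sym (+-assoc _ _ _))

    ι-* : ∀ m n → ι (m ℕ.* n) ≈ ι m * ι n
    ι-* zero    n = sym (zeroˡ _)
    ι-* (suc m) n = begin
      ι (n ℕ.+ m ℕ.* n)      ≈⟨ ι-+ n (m ℕ.* n) ⟩
      ι n + ι (m ℕ.* n)      ≈⟨ +-cong (sym (*-identityˡ _)) (ι-* m n) ⟩
      1# * ι n + ι m * ι n   ≈⟨ sym (distribʳ _ _ _) ⟩
      (1# + ι m) * ι n       ∎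

    -- Sends 0 and 1 to 0# and 1# on the nose, so that solver goals may contain these literals.
    ⟦_⟧ : ℤ → Carrier
    ⟦ + 1 ⟧      = 1#
    ⟦ + n ⟧      = ι n
    ⟦ -[1+ n ] ⟧ = - ι (suc n)

    ⟦+⟧ : ∀ n → ⟦ + n ⟧ ≈ ι n
    ⟦+⟧ 0             = refl
    ⟦+⟧ 1             = sym (+-identityʳ _)
    ⟦+⟧ (suc (suc n)) = refl

    neg : ∀ i → ⟦ ℤ.- i ⟧ ≈ - ⟦ i ⟧
    neg (+ 0)             = sym -0#≈0#
    neg (+ 1)             = -‿cong (+-identityʳ _)
    neg (+ suc (suc n))   = refl
    neg -[1+ n ]          = trans (⟦+⟧ (suc n)) (sym (-‿involutive _))

    ⊖-homo : ∀ m n → ⟦ m ℤ.⊖ n ⟧ ≈ ι m - ι n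
    ⊖-homo m       zero    = trans (⟦+⟧ m) (trans (sym (+-identityʳ _)) (+-congˡ (sym -0#≈0#)))
    ⊖-homo zero    (suc n) = sym (+-identityˡ _)
    ⊖-homo (suc m) (suc n) = begin
      ⟦ suc m ℤ.⊖ suc n ⟧              ≡⟨ ≡.cong ⟦_⟧ (ℤ.[1+m]⊖[1+n]≡m⊖n m n) ⟩
      ⟦ m ℤ.⊖ n ⟧                      ≈⟨ ⊖-homo m n ⟩
      ι m - ι n                        ≈⟨ +-congʳ (sym (+-identityˡ _)) ⟩
      0# + ι m - ι n                   ≈⟨ +-congʳ (+-congʳ (sym (-‿inverseʳ 1#))) ⟩
      (1# - 1#) + ι m - ι n            ≈⟨ +-congʳ (trans (+-assoc _ _ _) (trans (+-congˡ (+-comm _ _)) (sym (+-assoc _ _ _)))) ⟩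
      (1# + ι m) - 1# - ι n            ≈⟨ +-assoc _ _ _ ⟩
      (1# + ι m) + (- 1# - ι n)        ≈⟨ +-congˡ (⁻¹-∙-comm _ _) ⟩
      (1# + ι m) - (1# + ι n)          ∎

    +-homo : ∀ i j → ⟦ i ℤ.+ j ⟧ ≈ ⟦ i ⟧ + ⟦ j ⟧
    +-homo (+ m)    (+ n)    = trans (⟦+⟧ (m ℕ.+ n)) (trans (ι-+ m n) (+-cong (sym (⟦+⟧ m)) (sym (⟦+⟧ n))))
    +-homo (+ m)    -[1+ n ] = trans (⊖-homo m (suc n)) (+-congʳ (sym (⟦+⟧ m)))
    +-homo -[1+ m ] (+ n)    = trans (⊖-homo n (suc m)) (trans (+-comm _ _) (+-congˡ (sym (⟦+⟧ n))))
    +-homo -[1+ m ] -[1+ n ] = begin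
      - ι (suc (suc (m ℕ.+ n)))     ≡⟨ ≡.cong (λ k → - ι (suc k)) (≡.sym (ℕ.+-suc m n)) ⟩
      - ι (suc m ℕ.+ suc n)         ≈⟨ -‿cong (ι-+ (suc m) (suc n)) ⟩
      - (ι (suc m) + ι (suc n))     ≈⟨ sym (⁻¹-∙-comm _ _) ⟩
      - ι (suc m) + - ι (suc n)     ∎

    *-homo⁺ : ∀ m n → ⟦ + m ℤ.* + n ⟧ ≈ ⟦ + m ⟧ * ⟦ + n ⟧
    *-homo⁺ m n = begin
      ⟦ + m ℤ.* + n ⟧      ≡⟨ ≡.cong ⟦_⟧ (≡.sym (ℤ.pos-* m n)) ⟩
      ⟦ + (m ℕ.* n) ⟧      ≈⟨ ⟦+⟧ (m ℕ.* n) ⟩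
      ι (m ℕ.* n)          ≈⟨ ι-* m n ⟩
      ι m * ι n            ≈⟨ *-cong (sym (⟦+⟧ m)) (sym (⟦+⟧ n)) ⟩
      ⟦ + m ⟧ * ⟦ + n ⟧    ∎

    *-homo⁻ : ∀ i n → (∀ k → ⟦ i ℤ.* + k ⟧ ≈ ⟦ i ⟧ * ⟦ + k ⟧) → ⟦ i ℤ.* -[1+ n ] ⟧ ≈ ⟦ i ⟧ * ⟦ -[1+ n ] ⟧
    *-homo⁻ i n h = begin
      ⟦ i ℤ.* -[1+ n ] ⟧          ≡⟨ ≡.cong ⟦_⟧ (≡.sym (ℤ.neg-distribʳ-* i (+ suc n))) ⟩
      ⟦ ℤ.- (i ℤ.* + suc n) ⟧     ≈⟨ neg (i ℤ.* + suc n) ⟩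
      - ⟦ i ℤ.* + suc n ⟧         ≈⟨ -‿cong (h (suc n)) ⟩
      - (⟦ i ⟧ * ⟦ + suc n ⟧)     ≈⟨ -‿distribʳ-* _ _ ⟩
      ⟦ i ⟧ * - ⟦ + suc n ⟧       ≈⟨ *-congˡ (sym (neg (+ suc n))) ⟩
      ⟦ i ⟧ * ⟦ -[1+ n ] ⟧        ∎

    *-homo : ∀ i j → ⟦ i ℤ.* j ⟧ ≈ ⟦ i ⟧ * ⟦ j ⟧
    *-homo (+ m)    (+ n)    = *-homo⁺ m n
    *-homo (+ m)    -[1+ n ] = *-homo⁻ (+ m) n (*-homo⁺ m)
    *-homo -[1+ m ] (+ n)    = begin
      ⟦ -[1+ m ] ℤ.* + n ⟧     ≡⟨ ≡.cong ⟦_⟧ (ℤ.*-comm -[1+ m ] (+ n)) ⟩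
      ⟦ + n ℤ.* -[1+ m ] ⟧     ≈⟨ *-homo⁻ (+ n) m (*-homo⁺ n) ⟩
      ⟦ + n ⟧ * ⟦ -[1+ m ] ⟧   ≈⟨ *-comm _ _ ⟩
      ⟦ -[1+ m ] ⟧ * ⟦ + n ⟧   ∎
    *-homo -[1+ m ] -[1+ n ] = *-homo⁻ -[1+ m ] n (λ k → *-homo -[1+ m ] (+ k))

    ℤ⟶R : CommutativeRing.rawRing ℤ.+-*-commutativeRing -Raw-AlmostCommutative⟶ fromCommutativeRing R
    ℤ⟶R = record
      { ⟦_⟧ = ⟦_⟧ ; +-homo = +-homo ; *-homo = *-homo ; -‿homo = neg ; 0-homo = refl ; 1-homo = refl }

    coeff≟ : ∀ i j → Maybe (⟦ i ⟧ ≈ ⟦ j ⟧)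
    coeff≟ i j with i ℤ.≟ j
    ... | yes i≡j = just (reflexive (≡.cong ⟦_⟧ i≡j))
    ... | no  _   = nothing

  module IntegerSolver = RingSolver (CommutativeRing.rawRing ℤ.+-*-commutativeRing) (fromCommutativeRing R) ℤ⟶R coeff≟

-- Determinants as the unique normalised alternating forms.

module Determinants {c ℓ} (F : Field c ℓ) where
  open Field F
  open Vector using (_∷_)
  open CommutativeRing commutativeRing using
    ( setoid; refl; sym; trans; +-cong; +-congˡ; +-congʳ; *-cong; *-congˡ; *-congʳ; -‿cong
    ; +-identityˡ; +-identityʳ; *-identityˡ; *-identityʳ; zeroˡ; zeroʳ; distribˡ; *-comm; *-assoc )
  open IntegerSolver commutativeRing
  open SetoidReasoning setoid

  sumF-cong : ∀ {k} {f g : Fin k → Carrier} → (∀ i → f i ≈ g i) → sumF f ≈ sumF g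
  sumF-cong {zero}  h = refl
  sumF-cong {suc k} h = +-cong (h zero) (sumF-cong (h ∘ suc))

  sumF-zero : ∀ {k} {f : Fin k → Carrier} → (∀ i → f i ≈ 0#) → sumF f ≈ 0#
  sumF-zero {zero}  h = refl
  sumF-zero {suc k} h = trans (+-cong (h zero) (sumF-zero (h ∘ suc))) (+-identityˡ _)

  sumF-linear : ∀ {k} a b (f g : Fin k → Carrier) →
                sumF (λ i → a * f i + b * g i) ≈ a * sumF f + b * sumF g
  sumF-linear {zero}  a b f g = solve 2 (λ a b → con (+ 0) := a :* con (+ 0) :+ b :* con (+ 0)) refl a b
  sumF-linear {suc k} a b f g = begin
    a * f zero + b * g zero + sumF (λ i → a * f (suc i) + b * g (suc i))
      ≈⟨ +-congˡ (sumF-linear a b (f ∘ suc) (g ∘ suc)) ⟩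
    a * f zero + b * g zero + (a * sumF (f ∘ suc) + b * sumF (g ∘ suc))
      ≈⟨ solve 6 (λ a b p q r s → a :* p :+ b :* q :+ (a :* r :+ b :* s) := a :* (p :+ r) :+ b :* (q :+ s)) refl
           a b (f zero) (g zero) (sumF (f ∘ suc)) (sumF (g ∘ suc)) ⟩
    a * (f zero + sumF (f ∘ suc)) + b * (g zero + sumF (g ∘ suc)) ∎

  sumF-*ˡ : ∀ {k} a (f : Fin k → Carrier) → sumF (λ i → a * f i) ≈ a * sumF f
  sumF-*ˡ {zero}  a f = sym (zeroʳ a)
  sumF-*ˡ {suc k} a f = trans (+-congˡ (sumF-*ˡ a (f ∘ suc))) (sym (distribˡ _ _ _))

  -- Structural recursion instead of a decision of equality makes the tail of `δ (suc i)` reduce to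
  -- `δ i`, so the leaf-by-leaf inductions compute.
  δ : ∀ {k} → Fin k → Fin k → Carrier
  δ zero    zero    = 1#
  δ zero    (suc j) = 0#
  δ (suc i) zero    = 0#
  δ (suc i) (suc j) = δ i j

  δ-sym : ∀ {k} (i j : Fin k) → δ i j ≈ δ j i
  δ-sym zero    zero    = refl
  δ-sym zero    (suc j) = refl
  δ-sym (suc i) zero    = refl
  δ-sym (suc i) (suc j) = δ-sym i j

  δ-refl : ∀ {k} (i : Fin k) → δ i i ≈ 1#
  δ-refl zero    = refl
  δ-refl (suc i) = δ-refl i

  δ-≢ : ∀ {k} {i j : Fin k} → i ≢ j → δ i j ≈ 0#
  δ-≢ {i = zero}  {zero}  i≢j = contradiction ≡.refl i≢j
  δ-≢ {i = zero}  {suc j} _   = refl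
  δ-≢ {i = suc i} {zero}  _   = refl
  δ-≢ {i = suc i} {suc j} i≢j = δ-≢ (i≢j ∘ ≡.cong suc)

  δ-subst : ∀ {k} (i j : Fin k) (f : Fin k → Carrier) → δ i j * f i ≈ δ i j * f j
  δ-subst zero    zero    f = refl
  δ-subst zero    (suc j) f = trans (zeroˡ _) (sym (zeroˡ _))
  δ-subst (suc i) zero    f = trans (zeroˡ _) (sym (zeroˡ _))
  δ-subst (suc i) (suc j) f = δ-subst i j (f ∘ suc)

  sumF-δ : ∀ {k} (i : Fin k) (f : Fin k → Carrier) → sumF (λ j → δ i j * f j) ≈ f i
  sumF-δ {suc k} zero f = trans (+-cong (*-identityˡ _) (sumF-zero {k} (λ j → zeroˡ _))) (+-identityʳ _)
  sumF-δ (suc i) f = trans (+-cong (zeroˡ _) (sumF-δ i (f ∘ suc))) (+-identityˡ _)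

  Row : ℕ → Set c
  Row n = Fin n → Carrier

  infix 4 _≋_
  _≋_ : ∀ {n} → Row n → Row n → Set ℓ
  u ≋ v = ∀ j → u j ≈ v j

  infixl 6 _⊕_
  infixr 7 _⊙_
  _⊕_ : ∀ {n} → Row n → Row n → Row n
  (u ⊕ v) j = u j + v j

  _⊙_ : ∀ {n} → Carrier → Row n → Row n
  (a ⊙ v) j = a * v j

  record IsLinear {m n} (A : Row m → Row n) : Set (c ⊔ ℓ) where
    field
      resp : ∀ {u v} → u ≋ v → A u ≋ A v
      lin  : ∀ a b u v → A (a ⊙ u ⊕ b ⊙ v) ≋ a ⊙ A u ⊕ b ⊙ A v
  open IsLinear public

  Form : ℕ → ℕ → Set c
  Form k n = (Fin k → Row n) → Carrier

  -- Rows are functions, and neither function extensionality nor equality of field elements up to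
  -- `≡` is at hand, so compatibility with pointwise `≈` has to be carried along.
  Respects≋ : ∀ {k n} → Form k n → Set (c ⊔ ℓ)
  Respects≋ G = ∀ {M N} → (∀ i → M i ≋ N i) → G M ≈ G N

  -- A single row has no neighbour to coincide with; the trivial case lets `cons` have one shape for
  -- all sizes.
  AlternatingHead : ∀ k {n} → Form (suc k) n → Set (c ⊔ ℓ)
  AlternatingHead zero    G = ⊤
  AlternatingHead (suc k) G = ∀ v vs → G (v ∷ v ∷ vs) ≈ 0#

  -- Only adjacent equal rows are required to annihilate the form.
  data Alternating {n} : ∀ k → Form k n → Set (c ⊔ ℓ) where
    nil  : ∀ {G} → Respects≋ G → Alternating zero G
    cons : ∀ {k G} → Respects≋ G →
           (∀ a b u v vs → G ((a ⊙ u ⊕ b ⊙ v) ∷ vs) ≈ a * G (u ∷ vs) + b * G (v ∷ vs)) →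
           AlternatingHead k G →
           (∀ v → Alternating k (λ vs → G (v ∷ vs))) →
           Alternating (suc k) G

  respects : ∀ {k n} {G : Form k n} → Alternating k G → Respects≋ G
  respects (nil r)        = r
  respects (cons r _ _ _) = r

  ∷-cong : ∀ {k n} {u v : Row n} {us vs : Fin k → Row n} →
           u ≋ v → (∀ i → us i ≋ vs i) → ∀ i → (u ∷ us) i ≋ (v ∷ vs) i
  ∷-cong h hs zero    = h
  ∷-cong h hs (suc i) = hs i

  ∷-η : ∀ {k n} (M : Fin (suc k) → Row n) → ∀ i → M i ≋ (M zero ∷ M ∘ suc) i
  ∷-η M zero    j = refl
  ∷-η M (suc i) j = refl

  Alternating-resp : ∀ {k n} {G H : Form k n} → (∀ M → G M ≈ H M) → Alternating k G → Alternating k H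
  Alternating-resp {G = G} {H} e (nil r) = nil (λ {M} {N} h → trans (sym (e M)) (trans (r h) (e N)))
  Alternating-resp {G = G} {H} e (cons {k} r l alt t) =
    cons (λ {M} {N} h → trans (sym (e M)) (trans (r h) (e N)))
         (λ a b u v vs → trans (sym (e _)) (trans (l a b u v vs) (+-cong (*-congˡ (e _)) (*-congˡ (e _)))))
         (altH k {e = e} alt)
         (λ v → Alternating-resp (λ vs → e (v ∷ vs)) (t v))
    where
    altH : ∀ k {G H : Form (suc k) _} {e : ∀ M → G M ≈ H M} → AlternatingHead k G → AlternatingHead k H
    altH zero    _ = _
    altH (suc k) {e = e} a v vs = trans (sym (e _)) (a v vs)

  Alternating-linear : ∀ {k n} {G H : Form k n} a b → Alternating k G → Alternating k H →
                       Alternating k (λ M → a * G M + b * H M)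
  Alternating-linear a b (nil r) (nil r′) = nil (λ h → +-cong (*-congˡ (r h)) (*-congˡ (r′ h)))
  Alternating-linear {G = G} {H} a b (cons {k} r l alt t) (cons r′ l′ alt′ t′) =
    cons (λ h → +-cong (*-congˡ (r h)) (*-congˡ (r′ h)))
         (λ p q u v vs → trans (+-cong (*-congˡ (l p q u v vs)) (*-congˡ (l′ p q u v vs)))
           (solve 8 (λ a b p q x y z w → a :* (p :* x :+ q :* y) :+ b :* (p :* z :+ q :* w)
                      := p :* (a :* x :+ b :* z) :+ q :* (a :* y :+ b :* w)) refl
              a b p q (G (u ∷ vs)) (G (v ∷ vs)) (H (u ∷ vs)) (H (v ∷ vs))))
         (altH k alt alt′)
         (λ v → Alternating-linear a b (t v) (t′ v))
    where
    altH : ∀ k {G H : Form (suc k) _} → AlternatingHead k G → AlternatingHead k H →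
           AlternatingHead k (λ M → a * G M + b * H M)
    altH zero    _ _ = _
    altH (suc k) x y v vs = trans (+-cong (trans (*-congˡ (x v vs)) (zeroʳ a)) (trans (*-congˡ (y v vs)) (zeroʳ b))) (+-identityˡ _)

  map-∷ : ∀ {k m n} (A : Row m → Row n) (v : Row m) (vs : Fin k → Row m) →
          ∀ i → A ((v ∷ vs) i) ≋ (A v ∷ A ∘ vs) i
  map-∷ A v vs zero    j = refl
  map-∷ A v vs (suc i) j = refl

  Alternating-map : ∀ {k m n} {G : Form k n} {A : Row m → Row n} → IsLinear A →
                    Alternating k G → Alternating k (λ M → G (A ∘ M))
  Alternating-map L (nil r) = nil (λ h → r (λ i → resp L (h i)))
  Alternating-map {G = G} {A} L (cons {k} r l alt t) =
    cons (λ h → r (λ i → resp L (h i)))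
         (λ a b u v vs → begin
           G (A ∘ ((a ⊙ u ⊕ b ⊙ v) ∷ vs))               ≈⟨ r (map-∷ A _ vs) ⟩
           G (A (a ⊙ u ⊕ b ⊙ v) ∷ A ∘ vs)               ≈⟨ r (∷-cong (lin L a b u v) (λ _ _ → refl)) ⟩
           G ((a ⊙ A u ⊕ b ⊙ A v) ∷ A ∘ vs)             ≈⟨ l a b (A u) (A v) (A ∘ vs) ⟩
           a * G (A u ∷ A ∘ vs) + b * G (A v ∷ A ∘ vs)
             ≈⟨ +-cong (*-congˡ (r (λ i j → sym (map-∷ A u vs i j)))) (*-congˡ (r (λ i j → sym (map-∷ A v vs i j)))) ⟩
           a * G (A ∘ (u ∷ vs)) + b * G (A ∘ (v ∷ vs))  ∎)
         (altH k r alt)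
         (λ v → Alternating-resp (λ vs → r (λ i j → sym (map-∷ A v vs i j))) (Alternating-map L (t (A v))))
    where
    altH : ∀ k {G : Form (suc k) _} → Respects≋ G → AlternatingHead k G → AlternatingHead k (λ M → G (A ∘ M))
    altH zero    _ _ = _
    altH (suc k) r x v vs =
      trans (r (λ { zero j → refl ; (suc zero) j → refl ; (suc (suc i)) j → refl })) (x (A v) (A ∘ vs))

  head-linear : ∀ {k n} {G : Form (suc k) n} → Alternating (suc k) G → ∀ a b u v vs →
                G ((a ⊙ u ⊕ b ⊙ v) ∷ vs) ≈ a * G (u ∷ vs) + b * G (v ∷ vs)
  head-linear (cons _ l _ _) = l

  head-alternating : ∀ {k n} {G : Form (suc k) n} → Alternating (suc k) G → AlternatingHead k G
  head-alternating (cons _ _ a _) = a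

  fix-head : ∀ {k n} {G : Form (suc k) n} → Alternating (suc k) G → ∀ v → Alternating k (λ vs → G (v ∷ vs))
  fix-head (cons _ _ _ t) = t

  -- Polarisation: `G` vanishes when both leading rows are `u + v`, and of the four terms of the
  -- expansion only the two mixed ones survive.
  swap-head : ∀ {k n} {G : Form (suc (suc k)) n} → Alternating (suc (suc k)) G →
              ∀ u v vs → G (u ∷ v ∷ vs) ≈ - G (v ∷ u ∷ vs)
  swap-head {n = n} {G} alt u v vs = begin
    G (u ∷ v ∷ vs)
      ≈⟨ solve 2 (λ x y → x := (con (+ 1) :* (con (+ 0) :+ x) :+ con (+ 1) :* (y :+ con (+ 0))) :- y) refl _ _ ⟩
    (1# * (0# + G (u ∷ v ∷ vs)) + 1# * (G (v ∷ u ∷ vs) + 0#)) - G (v ∷ u ∷ vs)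
      ≈⟨ +-congʳ (sym expand) ⟩
    0# - G (v ∷ u ∷ vs)
      ≈⟨ +-identityˡ _ ⟩
    - G (v ∷ u ∷ vs) ∎
    where
    w : Row n
    w = 1# ⊙ u ⊕ 1# ⊙ v
    second : ∀ x → G (x ∷ w ∷ vs) ≈ G (x ∷ u ∷ vs) + G (x ∷ v ∷ vs)
    second x = trans (head-linear (fix-head alt x) 1# 1# u v vs) (+-cong (*-identityˡ _) (*-identityˡ _))
    expand : 0# ≈ 1# * (0# + G (u ∷ v ∷ vs)) + 1# * (G (v ∷ u ∷ vs) + 0#)
    expand = begin
      0#                                          ≈⟨ sym (head-alternating alt w vs) ⟩
      G (w ∷ w ∷ vs)                              ≈⟨ head-linear alt 1# 1# u v (w ∷ vs) ⟩
      1# * G (u ∷ w ∷ vs) + 1# * G (v ∷ w ∷ vs)   ≈⟨ +-cong (*-congˡ (trans (second u) (+-congʳ (head-alternating alt u vs))))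
                                                            (*-congˡ (trans (second v) (+-congˡ (head-alternating alt v vs)))) ⟩
      1# * (0# + G (u ∷ v ∷ vs)) + 1# * (G (v ∷ u ∷ vs) + 0#) ∎

  -- Swapping `v` past the next row brings it one place closer to its copy, and fixing that row as
  -- the new head leaves a smaller instance.
  repeated-head : ∀ {k n} {G : Form (suc k) n} → Alternating (suc k) G →
                  ∀ v vs i → vs i ≋ v → G (v ∷ vs) ≈ 0#
  repeated-head {suc k} {G = G} alt@(cons r _ a t) v vs zero h =
    trans (r (∷-cong (λ _ → refl) (λ { zero → h ; (suc i) j → refl }))) (a v (vs ∘ suc))
  repeated-head {suc k} {G = G} alt@(cons r _ _ t) v vs (suc i) h = begin
    G (v ∷ vs)                        ≈⟨ r (∷-cong (λ _ → refl) (∷-η vs)) ⟩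
    G (v ∷ vs zero ∷ vs ∘ suc)        ≈⟨ swap-head alt v (vs zero) (vs ∘ suc) ⟩
    - G (vs zero ∷ v ∷ vs ∘ suc)      ≈⟨ -‿cong (repeated-head (t (vs zero)) v (vs ∘ suc) i h) ⟩
    - 0#                              ≈⟨ solve 0 (:- con (+ 0) := con (+ 0)) refl ⟩
    0#                                ∎

  -- The vanishing hypothesis is what a form obtained by fixing `x` as head row satisfies. It passes
  -- to the form with one more row fixed, so the rows can be cleared one by one.
  clear-rows : ∀ {k n} {G : Form k n} (x : Row n) → Alternating k G →
               (∀ vs i → vs i ≋ x → G vs ≈ 0#) →
               ∀ (a : Fin k → Carrier) us → G (λ i → us i ⊕ a i ⊙ x) ≈ G us
  clear-rows x (nil r) z a us = r (λ ())
  clear-rows {suc k} {G = G} x (cons r l _ t) z a us = begin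
    G (λ i → us i ⊕ a i ⊙ x)
      ≈⟨ r (λ { zero j → +-congʳ (sym (*-identityˡ _)) ; (suc i) j → refl }) ⟩
    G ((1# ⊙ us zero ⊕ a zero ⊙ x) ∷ rest)
      ≈⟨ l 1# (a zero) (us zero) x rest ⟩
    1# * G (us zero ∷ rest) + a zero * G (x ∷ rest)
      ≈⟨ +-cong (*-identityˡ _) (trans (*-congˡ (z (x ∷ rest) zero (λ _ → refl))) (zeroʳ _)) ⟩
    G (us zero ∷ rest) + 0#
      ≈⟨ +-identityʳ _ ⟩
    G (us zero ∷ rest)
      ≈⟨ clear-rows x (t (us zero)) (λ vs i h → z (us zero ∷ vs) (suc i) h) (a ∘ suc) (us ∘ suc) ⟩
    G (us zero ∷ us ∘ suc)
      ≈⟨ r (λ i j → sym (∷-η us i j)) ⟩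
    G us ∎
    where
    rest : Fin k → Row _
    rest i = us (suc i) ⊕ a (suc i) ⊙ x

  sgn : ∀ {k} → Fin k → Carrier
  sgn j = (- 1#) ^ toℕ j

  -- Row `j` needs `j` adjacent swaps, which gives exactly the sign of the cofactor expansion.
  move-to-head : ∀ {k n} {G : Form (suc k) n} → Alternating (suc k) G →
                 ∀ (vs : Fin (suc k) → Row n) j → G (vs j ∷ vs ∘ punchIn j) ≈ sgn j * G vs
  move-to-head (cons r _ _ _) vs zero = trans (r (λ i j → sym (∷-η vs i j))) (sym (*-identityˡ _))
  move-to-head {suc k} {G = G} alt@(cons r _ _ t) vs (suc j) = begin
    G (vs (suc j) ∷ vs ∘ punchIn (suc j))
      ≈⟨ r (∷-cong (λ _ → refl) (∷-η (vs ∘ punchIn (suc j)))) ⟩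
    G (vs (suc j) ∷ vs zero ∷ vs ∘ suc ∘ punchIn j)
      ≈⟨ swap-head alt _ _ _ ⟩
    - G (vs zero ∷ vs (suc j) ∷ vs ∘ suc ∘ punchIn j)
      ≈⟨ -‿cong (move-to-head (t (vs zero)) (vs ∘ suc) j) ⟩
    - (sgn j * G (vs zero ∷ vs ∘ suc))
      ≈⟨ solve 2 (λ s g → :- (s :* g) := (:- con (+ 1)) :* s :* g) refl _ _ ⟩
    - 1# * sgn j * G (vs zero ∷ vs ∘ suc)
      ≈⟨ *-congˡ (r (λ i j → sym (∷-η vs i j))) ⟩
    - 1# * sgn j * G vs ∎

  linear-expand : ∀ {n} (f : Row n → Carrier) → (∀ {u v} → u ≋ v → f u ≈ f v) →
                  (∀ a b u v → f (a ⊙ u ⊕ b ⊙ v) ≈ a * f u + b * f v) →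
                  ∀ v → f v ≈ sumF (λ j → v j * f (δ j))
  linear-expand {zero} f r l v = begin
    f v                    ≈⟨ r (λ ()) ⟩
    -- The only row of length zero is the zero combination of itself, so linearity forces the value
    -- 0, the empty sum.
    f (0# ⊙ v ⊕ 0# ⊙ v)    ≈⟨ l 0# 0# v v ⟩
    0# * f v + 0# * f v    ≈⟨ solve 1 (λ x → con (+ 0) :* x :+ con (+ 0) :* x := con (+ 0)) refl _ ⟩
    0#                     ∎
  linear-expand {suc n} f r l v = begin
    f v
      ≈⟨ r (λ { zero → solve 1 (λ x → x := x :* con (+ 1) :+ con (+ 1) :* con (+ 0)) refl _
              ; (suc j) → solve 2 (λ x y → y := x :* con (+ 0) :+ con (+ 1) :* y) refl (v zero) _ }) ⟩
    f (v zero ⊙ δ zero ⊕ 1# ⊙ (0# ∷ v ∘ suc))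
      ≈⟨ l _ _ _ _ ⟩
    v zero * f (δ zero) + 1# * f (0# ∷ v ∘ suc)
      ≈⟨ +-congˡ (trans (*-identityˡ _) (linear-expand (λ u → f (0# ∷ u))
           (λ h → r (λ { zero → refl ; (suc j) → h j }))
           (λ a b u w → trans (r (λ { zero → solve 2 (λ a b → con (+ 0) := a :* con (+ 0) :+ b :* con (+ 0)) refl a b
                                    ; (suc j) → refl })) (l a b _ _))
           (v ∘ suc))) ⟩
    v zero * f (δ zero) + sumF (λ j → v (suc j) * f (0# ∷ δ j))
      ≈⟨ +-congˡ (sumF-cong {n} (λ j → *-congˡ (r {0# ∷ δ j} {δ (suc j)} (λ { zero → refl ; (suc i) → refl })))) ⟩
    v zero * f (δ zero) + sumF (λ j → v (suc j) * f (δ (suc j))) ∎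

  -- A linear section of deleting column `j`; pulling a form back along it gives a form on minors.
  insertZero : ∀ {n} → Fin (suc n) → Row n → Row (suc n)
  insertZero zero    v           = 0# ∷ v
  insertZero {suc n} (suc j) v   = v zero ∷ insertZero j (v ∘ suc)

  insertZero-linear : ∀ {n} (j : Fin (suc n)) → IsLinear (insertZero j)
  insertZero-linear zero = record
    { resp = λ { h zero → refl ; h (suc i) → h i }
    ; lin  = λ { a b u v zero → solve 2 (λ a b → con (+ 0) := a :* con (+ 0) :+ b :* con (+ 0)) refl a b
               ; a b u v (suc i) → refl } }
  insertZero-linear {suc n} (suc j) = record
    { resp = λ { h zero → h zero ; h (suc i) → resp (insertZero-linear j) (h ∘ suc) i }
    ; lin  = λ { a b u v zero → refl ; a b u v (suc i) → lin (insertZero-linear j) a b (u ∘ suc) (v ∘ suc) i } }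

  insertZero-punchIn : ∀ {n} (j : Fin (suc n)) (v : Row (suc n)) →
                       v ≋ insertZero j (v ∘ punchIn j) ⊕ v j ⊙ δ j
  insertZero-punchIn zero v zero    = solve 1 (λ x → x := con (+ 0) :+ x :* con (+ 1)) refl _
  insertZero-punchIn zero v (suc i) = solve 2 (λ x y → x := x :+ y :* con (+ 0)) refl _ (v zero)
  insertZero-punchIn {suc n} (suc j) v zero    = solve 2 (λ x y → x := x :+ y :* con (+ 0)) refl _ (v (suc j))
  insertZero-punchIn {suc n} (suc j) v (suc i) = insertZero-punchIn j (v ∘ suc) i

  insertZero-δ : ∀ {n} (j : Fin (suc n)) (r : Fin n) → insertZero j (δ r) ≋ δ (punchIn j r)
  insertZero-δ zero r zero    = refl
  insertZero-δ zero r (suc i) = refl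
  insertZero-δ {suc n} (suc j) zero    zero    = refl
  insertZero-δ {suc n} (suc j) zero    (suc i) = trans (resp (insertZero-linear j) {v = λ _ → 0#} (λ _ → refl) i) (zeros j i)
    where
    zeros : ∀ {n} (j : Fin (suc n)) → insertZero j (λ _ → 0#) ≋ λ _ → 0#
    zeros zero zero    = refl
    zeros zero (suc i) = refl
    zeros {suc n} (suc j) zero    = refl
    zeros {suc n} (suc j) (suc i) = zeros j i
  insertZero-δ {suc n} (suc j) (suc r) zero    = refl
  insertZero-δ {suc n} (suc j) (suc r) (suc i) = insertZero-δ j r i

  minor : ∀ {k} → (Fin (suc k) → Row (suc k)) → Fin (suc k) → Fin k → Row k
  minor M j r c = M (suc r) (punchIn j c)

  -- The first row is expanded in the standard basis. With `δ j` as head, column `j` of the other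
  -- rows can be cleared, and the remaining form in the minor is handled by induction. Moving `δ j`
  -- back to its place yields the sign, so the recursion that appears is the one defining `det`.
  alternating-unique : ∀ {k} {G : Form k k} → Alternating k G → ∀ M → G M ≈ det M * G δ
  alternating-unique (nil r) M = trans (r (λ ())) (sym (*-identityˡ _))
  alternating-unique {suc k} {G} alt@(cons r l a t) M = begin
    G M
      ≈⟨ r (∷-η M) ⟩
    G (M zero ∷ M ∘ suc)
      ≈⟨ linear-expand (λ v → G (v ∷ M ∘ suc)) (λ h → r (∷-cong h (λ _ _ → refl)))
           (λ p q u v → l p q u v (M ∘ suc)) (M zero) ⟩
    sumF (λ j → M zero j * G (δ j ∷ M ∘ suc))
      ≈⟨ sumF-cong (λ j → *-congˡ {M zero j} (expand j)) ⟩
    sumF (λ j → M zero j * (det (minor M j) * (sgn j * G δ)))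
      ≈⟨ sumF-cong (λ j → solve 4 (λ m d s g → m :* (d :* (s :* g)) := g :* (s :* (m :* d))) refl
           (M zero j) (det (minor M j)) (sgn j) (G δ)) ⟩
    sumF (λ j → G δ * (sgn j * (M zero j * det (minor M j))))
      ≈⟨ sumF-*ˡ (G δ) (λ j → sgn j * (M zero j * det (minor M j))) ⟩
    G δ * det M
      ≈⟨ *-comm _ _ ⟩
    det M * G δ ∎
    where
    expand : ∀ j → G (δ j ∷ M ∘ suc) ≈ det (minor M j) * (sgn j * G δ)
    expand j = begin
      G (δ j ∷ M ∘ suc)
        ≈⟨ r (∷-cong (λ _ → refl) (λ i → insertZero-punchIn j (M (suc i)))) ⟩
      G (δ j ∷ λ i → insertZero j (minor M j i) ⊕ M (suc i) j ⊙ δ j)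
        ≈⟨ clear-rows (δ j) (t (δ j)) (λ vs i h → repeated-head alt (δ j) vs i h) (λ i → M (suc i) j) _ ⟩
      G (δ j ∷ insertZero j ∘ minor M j)
        ≈⟨ alternating-unique (Alternating-map (insertZero-linear j) (t (δ j))) (minor M j) ⟩
      det (minor M j) * G (δ j ∷ insertZero j ∘ δ)
        ≈⟨ *-congˡ (trans (r (∷-cong (λ _ → refl) (insertZero-δ j))) (move-to-head alt δ j)) ⟩
      det (minor M j) * (sgn j * G δ) ∎

  -- Arbitrary forms take the place of the minors, so that columnExpansion-∷ can peel off one row at a time.
  columnExpansion : ∀ {k n} → Form k n → Form (suc k) (suc n)
  columnExpansion G M = sumF (λ j → sgn j * (M j zero * G (λ i c → M (punchIn j i) (suc c))))

  tail-linear : ∀ {n} → IsLinear {suc n} {n} (_∘ suc)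
  tail-linear = record { resp = λ h j → h (suc j) ; lin = λ a b u v j → refl }

  columnExpansion-cong : ∀ {k n} {G H : Form k n} → (∀ M → G M ≈ H M) → ∀ M → columnExpansion G M ≈ columnExpansion H M
  columnExpansion-cong e M = sumF-cong (λ j → *-congˡ {sgn j} (*-congˡ {M j zero} (e (λ i c → M (punchIn j i) (suc c)))))

  columnExpansion-∷ : ∀ {k n} {G : Form (suc k) n} → Respects≋ G → ∀ v vs →
    columnExpansion G (v ∷ vs) ≈ v zero * G (λ i → vs i ∘ suc) + - 1# * columnExpansion (λ us → G (v ∘ suc ∷ us)) vs
  columnExpansion-∷ {G = G} r v vs = begin
    1# * (v zero * G (λ i c → vs i (suc c)))
      + sumF (λ j → - 1# * sgn j * (vs j zero * G (λ i c → (v ∷ vs) (punchIn (suc j) i) (suc c))))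
      ≈⟨ +-cong (*-identityˡ _) (sumF-cong (λ j → trans (*-congˡ { - 1# * sgn j} (*-congˡ {vs j zero}
           (r {λ i c → (v ∷ vs) (punchIn (suc j) i) (suc c)} {v ∘ suc ∷ (λ i c → vs (punchIn j i) (suc c))} (λ { zero c → refl ; (suc i) c → refl })))) (*-assoc _ _ _))) ⟩
    v zero * G (λ i → vs i ∘ suc)
      + sumF (λ j → - 1# * (sgn j * (vs j zero * G (v ∘ suc ∷ λ i c → vs (punchIn j i) (suc c)))))
      ≈⟨ +-congˡ (sumF-*ˡ (- 1#) (λ j → sgn j * (vs j zero * G (v ∘ suc ∷ λ i c → vs (punchIn j i) (suc c))))) ⟩
    v zero * G (λ i → vs i ∘ suc) + - 1# * columnExpansion (λ us → G (v ∘ suc ∷ us)) vs ∎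

  columnExpansion-linear : ∀ {k n} (G H : Form k n) a b M →
    columnExpansion (λ us → a * G us + b * H us) M ≈ a * columnExpansion G M + b * columnExpansion H M
  columnExpansion-linear G H a b M = trans
    (sumF-cong (λ j → solve 6 (λ s m a b x y → s :* (m :* (a :* x :+ b :* y)) := a :* (s :* (m :* x)) :+ b :* (s :* (m :* y))) refl
      (sgn j) (M j zero) a b (G (M′ j)) (H (M′ j))))
    (sumF-linear a b (λ j → sgn j * (M j zero * G (M′ j))) (λ j → sgn j * (M j zero * H (M′ j))))
    where
    M′ : ∀ j i c → Carrier
    M′ j i c = M (punchIn j i) (suc c)

  -- When the two leading rows agree, the first two terms cancel by their signs, and every later
  -- term keeps both copies and vanishes because `G` alternates (`twice`).
  columnExpansion-alternating : ∀ {k n} {G : Form k n} → Alternating k G → Alternating (suc k) (columnExpansion G)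
  columnExpansion-alternating {zero} {G = G} (nil r) =
    cons (λ h → +-congʳ (*-congˡ (*-cong (h zero zero) (r (λ ())))))
         (λ a b u v vs → trans
           (solve 5 (λ a b u v g → con (+ 1) :* ((a :* u :+ b :* v) :* g) :+ con (+ 0)
              := a :* (con (+ 1) :* (u :* g) :+ con (+ 0)) :+ b :* (con (+ 1) :* (v :* g) :+ con (+ 0))) refl
              a b (u zero) (v zero) _)
           (+-cong (*-congˡ (+-congʳ (*-congˡ (*-congˡ (r (λ ())))))) (*-congˡ (+-congʳ (*-congˡ (*-congˡ (r (λ ()))))))))
         _
         (λ v → nil (λ _ → +-congʳ (*-congˡ (*-congˡ (r (λ ()))))))
  columnExpansion-alternating {suc k} {G = G} alt@(cons r l a t) =
    cons (λ h → sumF-cong (λ j → *-congˡ {sgn j} (*-cong (h j zero) (r (λ i c → h (punchIn j i) (suc c))))))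
         (λ p q u v vs → begin
           E ((p ⊙ u ⊕ q ⊙ v) ∷ vs)
             ≈⟨ columnExpansion-∷ r _ vs ⟩
           (p * u zero + q * v zero) * G (tails vs) + - 1# * columnExpansion (λ us → G ((p ⊙ u ⊕ q ⊙ v) ∘ suc ∷ us)) vs
             ≈⟨ +-congˡ (*-congˡ (trans (columnExpansion-cong (λ us → l p q (u ∘ suc) (v ∘ suc) us) vs)
                                        (columnExpansion-linear (λ us → G (u ∘ suc ∷ us)) (λ us → G (v ∘ suc ∷ us)) p q vs))) ⟩
           (p * u zero + q * v zero) * G (tails vs)
             + - 1# * (p * columnExpansion (λ us → G (u ∘ suc ∷ us)) vs + q * columnExpansion (λ us → G (v ∘ suc ∷ us)) vs)
             ≈⟨ solve 7 (λ p q u v g x y → (p :* u :+ q :* v) :* g :+ (:- con (+ 1)) :* (p :* x :+ q :* y)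
                   := p :* (u :* g :+ (:- con (+ 1)) :* x) :+ q :* (v :* g :+ (:- con (+ 1)) :* y)) refl
                   p q (u zero) (v zero) (G (tails vs)) _ _ ⟩
           _ ≈⟨ +-cong (*-congˡ (sym (columnExpansion-∷ r u vs))) (*-congˡ (sym (columnExpansion-∷ r v vs))) ⟩
           p * E (u ∷ vs) + q * E (v ∷ vs) ∎)
         (λ v vs → begin
           E (v ∷ v ∷ vs)
             ≈⟨ columnExpansion-∷ r v (v ∷ vs) ⟩
           v zero * G (tails (v ∷ vs)) + - 1# * columnExpansion (λ us → G (v ∘ suc ∷ us)) (v ∷ vs)
             ≈⟨ +-cong (*-congˡ (r (map-∷ (_∘ suc) v vs))) (*-congˡ (twice k {t = t} v vs a)) ⟩
           v zero * G (v ∘ suc ∷ tails vs) + - 1# * (v zero * G (v ∘ suc ∷ tails vs))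
             ≈⟨ solve 1 (λ x → x :+ (:- con (+ 1)) :* x := con (+ 0)) refl _ ⟩
           0# ∎)
         (λ v → Alternating-resp (λ vs → sym (columnExpansion-∷ r v vs))
                  (Alternating-linear (v zero) (- 1#) (Alternating-map tail-linear alt)
                    (columnExpansion-alternating (t (v ∘ suc)))))
    where
    E : Form (suc (suc k)) _
    E = columnExpansion G
    tails : ∀ {k n} → (Fin k → Row (suc n)) → Fin k → Row n
    tails vs i = vs i ∘ suc
    twice : ∀ k {n} {G : Form (suc k) n} {t : ∀ v → Alternating k (λ vs → G (v ∷ vs))} v vs → AlternatingHead k G →
            columnExpansion (λ us → G (v ∘ suc ∷ us)) (v ∷ vs) ≈ v zero * G (v ∘ suc ∷ tails vs)
    twice zero {G = G} {t} v vs _ = trans (+-identityʳ _) (trans (*-identityˡ _) (*-congˡ (respects (t (v ∘ suc)) (λ ()))))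
    twice (suc k) {G = G} {t} v vs a = begin
      columnExpansion (λ us → G (v ∘ suc ∷ us)) (v ∷ vs)
        ≈⟨ columnExpansion-∷ (respects (t (v ∘ suc))) v vs ⟩
      v zero * G (v ∘ suc ∷ tails vs) + - 1# * columnExpansion (λ us → G (v ∘ suc ∷ v ∘ suc ∷ us)) vs
        ≈⟨ +-congˡ (trans (*-congˡ (sumF-zero (λ j → trans (*-congˡ {sgn j} (trans (*-congˡ {vs j zero} (a (v ∘ suc) (λ i c → vs (punchIn j i) (suc c)))) (zeroʳ _))) (zeroʳ _)))) (zeroʳ _)) ⟩
      v zero * G (v ∘ suc ∷ tails vs) + 0#
        ≈⟨ +-identityʳ _ ⟩
      v zero * G (v ∘ suc ∷ tails vs) ∎

  det-cong : ∀ {k} → Respects≋ (det {k})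
  det-cong {zero}  h = refl
  det-cong {suc k} h = sumF-cong (λ j → *-congˡ {sgn j} (*-cong (h zero j) (det-cong (λ i c → h (suc i) (punchIn j c)))))

  detᵀ : ∀ {k} → Form k k
  detᵀ M = det (λ i j → M j i)

  -- Expanding the transpose along its first row is, by definition, `columnExpansion` of `detᵀ`.
  -- This form treats all rows alike, while the expansion in `det` singles out the first;
  -- alternation of `det` then follows through uniqueness, as both forms take the value 1 at `δ`.
  detᵀ-alternating : ∀ k → Alternating k (detᵀ {k})
  detᵀ-alternating zero    = nil (λ _ → refl)
  detᵀ-alternating (suc k) = columnExpansion-alternating (detᵀ-alternating k)

  det-row₀ : ∀ {k} (M : Fin (suc k) → Row (suc k)) → (∀ j → M zero (suc j) ≈ 0#) →
             det M ≈ M zero zero * det (λ i j → M (suc i) (suc j))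
  det-row₀ {k} M h = trans (+-cong (*-identityˡ _) (sumF-zero {k} (λ j → trans (*-congˡ (trans (*-congʳ (h j)) (zeroˡ _))) (zeroʳ _)))) (+-identityʳ _)

  det-δ : ∀ k → det (δ {k}) ≈ 1#
  det-δ zero    = refl
  det-δ (suc k) = trans (det-row₀ {k} δ (λ _ → refl)) (trans (*-identityˡ _) (det-δ k))

  det-transpose : ∀ {k} (M : Fin k → Row k) → det (λ i j → M j i) ≈ det M
  det-transpose {k} M = begin
    detᵀ M           ≈⟨ alternating-unique {k} (detᵀ-alternating k) M ⟩
    det M * detᵀ {k} δ   ≈⟨ *-congˡ (trans (det-cong {k} {λ i j → δ j i} {δ} (λ i j → δ-sym j i)) (det-δ k)) ⟩
    det M * 1#       ≈⟨ *-identityʳ _ ⟩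
    det M            ∎

  det-alternating : ∀ k → Alternating k (det {k})
  det-alternating k = Alternating-resp det-transpose (detᵀ-alternating k)

  -- The product formula in disguise: `A ∘ δ` is the matrix of `A`. Column operations can thus be
  -- given as maps of rows, without matrix products.
  det-linear : ∀ {k} {A : Row k → Row k} → IsLinear A → ∀ M → det (A ∘ M) ≈ det M * det (A ∘ δ)
  det-linear {k} L = alternating-unique (Alternating-map L (det-alternating k))

  det-col₀ : ∀ {k} (M : Fin (suc k) → Row (suc k)) → (∀ i → M (suc i) zero ≈ 0#) →
             det M ≈ M zero zero * det (λ i j → M (suc i) (suc j))
  det-col₀ M h = begin
    det M                                            ≈⟨ sym (det-transpose M) ⟩
    det (λ i j → M j i)                              ≈⟨ det-row₀ (λ i j → M j i) h ⟩
    M zero zero * det (λ i j → M (suc j) (suc i))    ≈⟨ *-congˡ (det-transpose (λ i j → M (suc i) (suc j))) ⟩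
    M zero zero * det (λ i j → M (suc i) (suc j))    ∎

  prodF-cong : ∀ {k} {f g : Fin k → Carrier} → (∀ i → f i ≈ g i) → prodF f ≈ prodF g
  prodF-cong {zero}  h = refl
  prodF-cong {suc k} h = *-cong (h zero) (prodF-cong (h ∘ suc))

  det-diagonal : ∀ {k} (d : Row k) → det (λ i j → δ i j * d j) ≈ prodF d
  det-diagonal {zero}  d = refl
  det-diagonal {suc k} d = trans (det-row₀ (λ i j → δ i j * d j) (λ _ → zeroˡ _)) (*-cong (*-identityˡ _) (det-diagonal (d ∘ suc)))

  scale-linear : ∀ {k} (d : Row k) → IsLinear (λ v j → v j * d j)
  scale-linear d = record
    { resp = λ h j → *-congʳ (h j)
    ; lin  = λ a b u v j → solve 5 (λ a b u v d → (a :* u :+ b :* v) :* d := a :* (u :* d) :+ b :* (v :* d)) refl a b (u j) (v j) (d j) }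

  det-scale-columns : ∀ {k} (d : Row k) M → det (λ i j → M i j * d j) ≈ det M * prodF d
  det-scale-columns d M = trans (det-linear (scale-linear d) M) (*-congˡ (det-diagonal d))

  det-scale-rows : ∀ {k} (d : Row k) M → det (λ i j → d i * M i j) ≈ prodF d * det M
  det-scale-rows d M = begin
    det (λ i j → d i * M i j)   ≈⟨ sym (det-transpose (λ i j → d i * M i j)) ⟩
    det (λ i j → d j * M j i)   ≈⟨ det-cong (λ i j → *-comm (d j) (M j i)) ⟩
    det (λ i j → M j i * d j)   ≈⟨ det-scale-columns d (λ i j → M j i) ⟩
    det (λ i j → M j i) * prodF d ≈⟨ *-comm _ _ ⟩
    prodF d * det (λ i j → M j i) ≈⟨ *-congˡ (det-transpose M) ⟩
    prodF d * det M             ∎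

-- Trees built from leaves, and difference operators on them.

module LeafExtensions {c ℓ} (F : Field c ℓ) where
  open Field F
  open Determinants F
  open CommutativeRing commutativeRing using
    ( setoid; refl; sym; trans; +-cong; +-congˡ; +-congʳ; *-cong; *-congˡ; *-congʳ; -‿cong
    ; +-identityˡ; +-identityʳ; *-identityˡ; *-identityʳ; zeroˡ; distribˡ; *-comm; *-assoc )
  open IntegerSolver commutativeRing
  open SetoidReasoning setoid

  -- Weighted trees on Fin (suc k) built by attaching leaves: the newest leaf is
  -- zero, the root is fromℕ k, and every other vertex stands for the edge to its parent.
  data Tree : ℕ → Set c where
    vertex : Tree zero
    leaf   : ∀ {k} → Tree k → Fin (suc k) → Carrier → Tree (suc k)

  ρ : ∀ {k} → Row (suc k)
  ρ {k} = δ (fromℕ k)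

  d : ∀ {k} → Tree k → Fin (suc k) → Row (suc k)
  d vertex       i       j       = 0#
  d (leaf T q w) zero    zero    = 0#
  d (leaf T q w) zero    (suc j) = w + d T q j
  d (leaf T q w) (suc i) zero    = w + d T q i
  d (leaf T q w) (suc i) (suc j) = d T i j

  ω : ∀ {k} → Tree k → Row (suc k)
  ω vertex       _       = 1#
  ω (leaf T q w) zero    = w
  ω (leaf T q w) (suc i) = ω T i

  τ : ∀ {k} → Tree k → Row (suc k)
  τ vertex       _       = ι 2
  τ (leaf T q w) zero    = 1#
  τ (leaf T q w) (suc v) = τ T v - δ q v

  ŵ : ∀ {k} → Tree k → Row (suc k)
  ŵ vertex       _       = 0#
  ŵ (leaf T q w) zero    = w
  ŵ (leaf T q w) (suc v) = ŵ T v + δ q v * w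

  -- d T i e minus d T i (parent of e) is σ T i e * ω T e: the sign tells whether
  -- the edge e separates i from the root. In the root column, σ T i is the distance to the root.
  σ : ∀ {k} → Tree k → Fin (suc k) → Row (suc k)
  σ vertex       i       e       = 0#
  σ (leaf T q w) zero    zero    = - 1#
  σ (leaf T q w) zero    (suc e) = σ T q e + w * ρ e
  σ (leaf T q w) (suc i) zero    = 1#
  σ (leaf T q w) (suc i) (suc e) = σ T i e

  -- Attaching a leaf to `q` changes a squared distance `x * x` into `x * x + 2 w x + w * w`. The
  -- term in `x` gives the part with `σ`; the constant is seen by `∇` only at the root and gives the
  -- part with `ρ`. One factor `w` is divided out.
  attach : ∀ {k} → Tree k → Fin (suc k) → Carrier → Row (suc k)
  attach T q w e = ι 2 * σ T q e + w * ρ e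

  -- The second differences of the squared distances, with the edge weights divided out (see ∇-squares).
  B : ∀ {k} → Tree k → Fin (suc k) → Row (suc k)
  B vertex       e       f       = 0#
  B (leaf T q w) zero    zero    = - ι 2
  B (leaf T q w) zero    (suc f) = attach T q w f
  B (leaf T q w) (suc e) zero    = attach T q w e
  B (leaf T q w) (suc e) (suc f) = B T e f

  -- At an edge, the sum of the distances from the root to its two ends; at the root, 0.
  κ : ∀ {k} → Tree k → Row (suc k)
  κ {k} T e = B T e (fromℕ k)

  -- Differences along the edges to the parents, but the value itself at the root.
  ∇ : ∀ {k} → Tree k → Row (suc k) → Row (suc k)
  ∇ vertex       u         = u
  ∇ (leaf T q w) u zero    = u zero - u (suc q)
  ∇ (leaf T q w) u (suc e) = ∇ T (u ∘ suc) e

  ∇ᵀ : ∀ {k} → Tree k → Row (suc k) → Row (suc k)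
  ∇ᵀ vertex       u         = u
  ∇ᵀ (leaf T q w) u zero    = u zero
  ∇ᵀ (leaf T q w) u (suc v) = ∇ᵀ T (u ∘ suc) v - δ q v * u zero

  ∇-linear : ∀ {k} (T : Tree k) → IsLinear (∇ T)
  ∇-linear vertex = record { resp = λ h → h ; lin = λ _ _ _ _ _ → refl }
  ∇-linear (leaf T q w) = record
    { resp = λ { h zero → +-cong (h zero) (-‿cong (h (suc q))) ; h (suc e) → resp (∇-linear T) (h ∘ suc) e }
    ; lin  = λ { a b u v zero → solve 6 (λ a b x y z w → a :* x :+ b :* y :- (a :* z :+ b :* w) := a :* (x :- z) :+ b :* (y :- w)) refl
                   a b (u zero) (v zero) (u (suc q)) (v (suc q))
               ; a b u v (suc e) → lin (∇-linear T) a b (u ∘ suc) (v ∘ suc) e } }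

  ∇ᵀ-linear : ∀ {k} (T : Tree k) → IsLinear (∇ᵀ T)
  ∇ᵀ-linear vertex = record { resp = λ h → h ; lin = λ _ _ _ _ _ → refl }
  ∇ᵀ-linear (leaf T q w) = record
    { resp = λ { h zero → h zero ; h (suc v) → +-cong (resp (∇ᵀ-linear T) (h ∘ suc) v) (-‿cong (*-congˡ (h zero))) }
    ; lin  = λ { a b u v zero → refl
               ; a b u v (suc i) → trans (+-congʳ (lin (∇ᵀ-linear T) a b (u ∘ suc) (v ∘ suc) i))
                   (solve 7 (λ a b x y p r s → a :* x :+ b :* y :- p :* (a :* r :+ b :* s) := a :* (x :- p :* r) :+ b :* (y :- p :* s)) refl
                     a b (∇ᵀ T (u ∘ suc) i) (∇ᵀ T (v ∘ suc) i) (δ q i) (u zero) (v zero)) } }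

  linear-zero : ∀ {m n} {A : Row m → Row n} → IsLinear A → A (λ _ → 0#) ≋ λ _ → 0#
  linear-zero L j = trans (resp L (λ _ → solve 0 (con (+ 0) := con (+ 0) :* con (+ 0) :+ con (+ 0) :* con (+ 0)) refl) j)
    (trans (lin L 0# 0# (λ _ → 0#) (λ _ → 0#) j) (solve 1 (λ x → con (+ 0) :* x :+ con (+ 0) :* x := con (+ 0)) refl _))

  -- The newest leaf has index `zero` and no children, so the matrix is unitriangular and a
  -- first-row expansion suffices.
  det-∇ : ∀ {k} (T : Tree k) → det (∇ T ∘ δ) ≈ 1#
  det-∇ vertex       = det-δ 1
  det-∇ (leaf T q w) = begin
    det (∇ (leaf T q w) ∘ δ)      ≈⟨ det-row₀ (∇ (leaf T q w) ∘ δ) (linear-zero (∇-linear T)) ⟩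
    (1# - 0#) * det (∇ T ∘ δ)     ≈⟨ *-congˡ (det-∇ T) ⟩
    (1# - 0#) * 1#                ≈⟨ solve 0 ((con (+ 1) :- con (+ 0)) :* con (+ 1) := con (+ 1)) refl ⟩
    1#                            ∎

  det-∇ᵀ : ∀ {k} (T : Tree k) → det (∇ᵀ T ∘ δ) ≈ 1#
  det-∇ᵀ vertex       = det-δ 1
  det-∇ᵀ (leaf T q w) = begin
    det (∇ᵀ (leaf T q w) ∘ δ)                         ≈⟨ det-col₀ (∇ᵀ (leaf T q w) ∘ δ) (λ _ → refl) ⟩
    1# * det (λ i j → ∇ᵀ T (δ i) j - δ q j * 0#)
      ≈⟨ *-congˡ (det-cong {N = ∇ᵀ T ∘ δ} (λ i j → solve 2 (λ x y → x :- y :* con (+ 0) := x) refl (∇ᵀ T (δ i) j) (δ q j))) ⟩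
    1# * det (∇ᵀ T ∘ δ)                               ≈⟨ *-congˡ (det-∇ᵀ T) ⟩
    1# * 1#                                           ≈⟨ *-identityˡ _ ⟩
    1#                                                ∎

  ω-root : ∀ {k} (T : Tree k) → ω T (fromℕ k) ≈ 1#
  ω-root vertex       = refl
  ω-root (leaf T q w) = ω-root T

  ρ-ω : ∀ {k} (T : Tree k) f → ρ f * ω T f ≈ ρ f
  ρ-ω {k} T f = trans (sym (δ-subst (fromℕ k) f (ω T))) (trans (*-congˡ (ω-root T)) (*-identityʳ _))

  ρ-root : ∀ k → ρ (fromℕ k) ≈ 1#
  ρ-root k = δ-refl (fromℕ k)

  d-sym : ∀ {k} (T : Tree k) i j → d T i j ≈ d T j i
  d-sym vertex       i       j       = refl
  d-sym (leaf T q w) zero    zero    = refl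
  d-sym (leaf T q w) zero    (suc j) = refl
  d-sym (leaf T q w) (suc i) zero    = refl
  d-sym (leaf T q w) (suc i) (suc j) = d-sym T i j

  d-refl : ∀ {k} (T : Tree k) i → d T i i ≈ 0#
  d-refl vertex       i       = refl
  d-refl (leaf T q w) zero    = refl
  d-refl (leaf T q w) (suc i) = d-refl T i

  B-sym : ∀ {k} (T : Tree k) e f → B T e f ≈ B T f e
  B-sym vertex       e       f       = refl
  B-sym (leaf T q w) zero    zero    = refl
  B-sym (leaf T q w) zero    (suc f) = refl
  B-sym (leaf T q w) (suc e) zero    = refl
  B-sym (leaf T q w) (suc e) (suc f) = B-sym T e f

  κ-root : ∀ {k} (T : Tree k) → κ T (fromℕ k) ≈ 0#
  κ-root vertex       = refl
  κ-root (leaf T q w) = κ-root T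

  ∇-root : ∀ {k} (T : Tree k) u → ∇ T u (fromℕ k) ≈ u (fromℕ k)
  ∇-root vertex       u = refl
  ∇-root (leaf T q w) u = ∇-root T (u ∘ suc)

  ∇-shift : ∀ {k} (T : Tree k) a u e → ∇ T (λ i → a + u i) e ≈ a * ρ e + ∇ T u e
  ∇-shift vertex       a u zero    = +-congʳ (sym (*-identityʳ a))
  ∇-shift (leaf T q w) a u zero    = solve 3 (λ a x y → (a :+ x) :- (a :+ y) := a :* con (+ 0) :+ (x :- y)) refl a (u zero) (u (suc q))
  ∇-shift (leaf T q w) a u (suc e) = ∇-shift T a (u ∘ suc) e

  -- On the constant 1, `∇ᵀ` gives one minus the number of children. Away from the root this is 2
  -- minus the degree; at the root, which has no parent, it is one less.
  ∇ᵀ-shift : ∀ {k} (T : Tree k) a u v → ∇ᵀ T (λ e → u e + a) v ≈ ∇ᵀ T u v + a * (τ T v - ρ v)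
  ∇ᵀ-shift vertex       a u zero    = solve 2 (λ a x → x :+ a := x :+ a :* (con (+ 2) :- con (+ 1))) refl a (u zero)
  ∇ᵀ-shift (leaf T q w) a u zero    = solve 2 (λ a x → x :+ a := x :+ a :* (con (+ 1) :- con (+ 0))) refl a (u zero)
  ∇ᵀ-shift (leaf T q w) a u (suc v) = trans (+-congʳ (∇ᵀ-shift T a (u ∘ suc) v))
    (solve 6 (λ a x y t r p → x :+ a :* (t :- r) :- p :* (y :+ a) := (x :- p :* y) :+ a :* ((t :- p) :- r)) refl
      a (∇ᵀ T (u ∘ suc) v) (u zero) (τ T v) (ρ v) (δ q v))

  ∇-adjoint : ∀ {k} (T : Tree k) z a → sumF (λ e → ∇ T z e * a e) ≈ sumF (λ v → z v * ∇ᵀ T a v)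
  ∇-adjoint vertex       z a = refl
  ∇-adjoint (leaf T q w) z a = begin
    (z zero - z (suc q)) * a zero + sumF (λ e → ∇ T (z ∘ suc) e * a (suc e))
      ≈⟨ +-congˡ (∇-adjoint T (z ∘ suc) (a ∘ suc)) ⟩
    (z zero - z (suc q)) * a zero + sumF za
      ≈⟨ solve 4 (λ x y p s → (x :- y) :* p :+ s := x :* p :+ (con (+ 1) :* s :+ (:- p) :* y)) refl (z zero) (z (suc q)) (a zero) (sumF za) ⟩
    z zero * a zero + (1# * sumF za + (- a zero) * z (suc q))
      ≈⟨ +-congˡ (+-congˡ (*-congˡ (sym (sumF-δ q (z ∘ suc))))) ⟩
    z zero * a zero + (1# * sumF za + (- a zero) * sumF (λ v → δ q v * z (suc v)))
      ≈⟨ +-congˡ (sym (sumF-linear 1# (- a zero) za (λ v → δ q v * z (suc v)))) ⟩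
    z zero * a zero + sumF (λ v → 1# * za v + (- a zero) * (δ q v * z (suc v)))
      ≈⟨ +-congˡ (sumF-cong (λ v → solve 4 (λ z t p a → con (+ 1) :* (z :* t) :+ (:- a) :* (p :* z) := z :* (t :- p :* a)) refl
           (z (suc v)) (∇ᵀ T (a ∘ suc) v) (δ q v) (a zero))) ⟩
    z zero * a zero + sumF (λ v → z (suc v) * (∇ᵀ T (a ∘ suc) v - δ q v * a zero)) ∎
    where
    za : Row _
    za v = z (suc v) * ∇ᵀ T (a ∘ suc) v

  ∇-d : ∀ {k} (T : Tree k) i e → ∇ T (d T i) e ≈ σ T i e * ω T e
  ∇-d vertex       i       e       = sym (zeroˡ _)
  ∇-d (leaf T q w) zero    zero    = trans (+-congˡ (-‿cong (+-congˡ (d-refl T q))))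
    (solve 1 (λ w → con (+ 0) :- (w :+ con (+ 0)) := (:- con (+ 1)) :* w) refl w)
  ∇-d (leaf T q w) zero    (suc e) = begin
    ∇ T (λ j → w + d T q j) e               ≈⟨ ∇-shift T w (d T q) e ⟩
    w * ρ e + ∇ T (d T q) e                 ≈⟨ +-cong (*-congˡ (sym (ρ-ω T e))) (∇-d T q e) ⟩
    w * (ρ e * ω T e) + σ T q e * ω T e
      ≈⟨ solve 4 (λ w r o s → w :* (r :* o) :+ s :* o := (s :+ w :* r) :* o) refl w (ρ e) (ω T e) (σ T q e) ⟩
    (σ T q e + w * ρ e) * ω T e             ∎
  ∇-d (leaf T q w) (suc i) zero    = trans (+-congˡ (-‿cong (d-sym T i q)))
    (solve 2 (λ w x → (w :+ x) :- x := con (+ 1) :* w) refl w (d T q i))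
  ∇-d (leaf T q w) (suc i) (suc e) = ∇-d T i e

  ∇-attach : ∀ {k} (T : Tree k) q w e →
             ∇ T (λ j → (w + d T q j) * (w + d T q j) - d T q j * d T q j) e ≈ w * attach T q w e * ω T e
  ∇-attach T q w e = begin
    ∇ T (λ j → (w + d T q j) * (w + d T q j) - d T q j * d T q j) e
      -- The summand with coefficient 0 only supplies the two-term shape that `lin` expects.
      ≈⟨ resp (∇-linear T) (λ j → solve 2 (λ w x → (w :+ x) :* (w :+ x) :- x :* x
           := w :* w :+ (con (+ 2) :* w :* x :+ con (+ 0) :* x)) refl w (d T q j)) e ⟩
    ∇ T (λ j → w * w + (ι 2 * w * d T q j + 0# * d T q j)) e
      ≈⟨ ∇-shift T (w * w) _ e ⟩
    w * w * ρ e + ∇ T ((ι 2 * w) ⊙ d T q ⊕ 0# ⊙ d T q) e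
      ≈⟨ +-congˡ (trans (lin (∇-linear T) (ι 2 * w) 0# (d T q) (d T q) e) (trans (+-congˡ (zeroˡ _)) (+-identityʳ _))) ⟩
    w * w * ρ e + ι 2 * w * ∇ T (d T q) e
      ≈⟨ +-cong (*-congˡ (sym (ρ-ω T e))) (*-congˡ (∇-d T q e)) ⟩
    w * w * (ρ e * ω T e) + ι 2 * w * (σ T q e * ω T e)
      ≈⟨ solve 4 (λ w r o s → w :* w :* (r :* o) :+ con (+ 2) :* w :* (s :* o) := w :* (con (+ 2) :* s :+ w :* r) :* o) refl
           w (ρ e) (ω T e) (σ T q e) ⟩
    w * attach T q w e * ω T e ∎

  ∇-difference : ∀ {k} (T : Tree k) u v → ∇ T (λ j → u j - v j) ≋ λ e → ∇ T u e - ∇ T v e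
  ∇-difference T u v e = begin
    ∇ T (λ j → u j - v j) e
      ≈⟨ resp (∇-linear T) (λ j → solve 2 (λ x y → x :- y := con (+ 1) :* x :+ (:- con (+ 1)) :* y) refl (u j) (v j)) e ⟩
    ∇ T (1# ⊙ u ⊕ - 1# ⊙ v) e
      ≈⟨ lin (∇-linear T) 1# (- 1#) u v e ⟩
    1# * ∇ T u e + - 1# * ∇ T v e
      ≈⟨ solve 2 (λ x y → con (+ 1) :* x :+ (:- con (+ 1)) :* y := x :- y) refl _ _ ⟩
    ∇ T u e - ∇ T v e ∎

  ∇-squares : ∀ {k} (T : Tree k) e f →
              ∇ T (λ i → ∇ T (λ j → d T i j * d T i j) f) e ≈ ω T e * B T e f * ω T f
  ∇-squares vertex zero zero = solve 0 (con (+ 0) :* con (+ 0) := con (+ 1) :* con (+ 0) :* con (+ 1)) refl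
  ∇-squares (leaf T q w) zero zero = begin
    (0# * 0# - (w + d T q q) * (w + d T q q)) - ((w + d T q q) * (w + d T q q) - d T q q * d T q q)
      ≈⟨ solve 2 (λ w x → (con (+ 0) :* con (+ 0) :- (w :+ x) :* (w :+ x)) :- ((w :+ x) :* (w :+ x) :- x :* x)
           := w :* (:- con (+ 2)) :* w :+ x :* (:- (con (+ 4) :* w :+ x))) refl w (d T q q) ⟩
    w * - ι 2 * w + d T q q * - (ι 4 * w + d T q q)
      ≈⟨ +-congˡ (trans (*-congʳ (d-refl T q)) (zeroˡ _)) ⟩
    w * - ι 2 * w + 0#
      ≈⟨ +-identityʳ _ ⟩
    w * - ι 2 * w ∎
  ∇-squares (leaf T q w) zero (suc f) = begin
    ∇ T (λ j → (w + d T q j) * (w + d T q j)) f - ∇ T (λ j → d T q j * d T q j) f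
      ≈⟨ sym (∇-difference T _ _ f) ⟩
    ∇ T (λ j → (w + d T q j) * (w + d T q j) - d T q j * d T q j) f
      ≈⟨ ∇-attach T q w f ⟩
    w * attach T q w f * ω T f ∎
  ∇-squares (leaf T q w) (suc e) zero = begin
    ∇ T (λ i → (w + d T q i) * (w + d T q i) - d T i q * d T i q) e
      ≈⟨ resp (∇-linear T) (λ i → +-congˡ (-‿cong (*-cong (d-sym T i q) (d-sym T i q)))) e ⟩
    ∇ T (λ i → (w + d T q i) * (w + d T q i) - d T q i * d T q i) e
      ≈⟨ ∇-attach T q w e ⟩
    w * attach T q w e * ω T e
      ≈⟨ solve 3 (λ x y z → x :* y :* z := z :* y :* x) refl _ _ _ ⟩
    ω T e * attach T q w e * w ∎
  ∇-squares (leaf T q w) (suc e) (suc f) = ∇-squares T e f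

  ∇ᵀ-ρ : ∀ {k} (T : Tree k) → ∇ᵀ T ρ ≋ ρ
  ∇ᵀ-ρ vertex       i       = refl
  ∇ᵀ-ρ (leaf T q w) zero    = refl
  ∇ᵀ-ρ (leaf T q w) (suc i) = trans (+-cong (∇ᵀ-ρ T i) refl) (solve 2 (λ x y → x :- y :* con (+ 0) := x) refl _ (δ q i))

  -- Row `i` of `D L = 1 τᵀ - 2 I`: `σ T i` is `∇` of the distance row with the weights divided out,
  -- so applying `∇ᵀ` amounts to multiplying by the Laplacian. The last term is the root coordinate
  -- of `∇`, which the Laplacian does not have.
  ∇ᵀ-σ : ∀ {k} (T : Tree k) i v → ∇ᵀ T (σ T i) v ≈ τ T v - ι 2 * δ i v + σ T i (fromℕ k) * ρ v
  ∇ᵀ-σ vertex zero zero = solve 0 (con (+ 0) := con (+ 2) :- con (+ 2) :* con (+ 1) :+ con (+ 0) :* con (+ 1)) refl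
  ∇ᵀ-σ (leaf T q w) zero zero =
    solve 1 (λ x → :- con (+ 1) := con (+ 1) :- con (+ 2) :* con (+ 1) :+ x :* con (+ 0)) refl _
  ∇ᵀ-σ {suc k} (leaf T q w) zero (suc v) = begin
    ∇ᵀ T (λ e → σ T q e + w * ρ e) v - δ q v * - 1#
      ≈⟨ +-congʳ (trans (resp (∇ᵀ-linear T) (λ e → +-congʳ (sym (*-identityˡ _))) v) (lin (∇ᵀ-linear T) 1# w (σ T q) ρ v)) ⟩
    1# * ∇ᵀ T (σ T q) v + w * ∇ᵀ T ρ v - δ q v * - 1#
      ≈⟨ +-congʳ (+-cong (*-congˡ (∇ᵀ-σ T q v)) (*-congˡ (∇ᵀ-ρ T v))) ⟩
    1# * (τ T v - ι 2 * δ q v + σ T q (fromℕ k) * ρ v) + w * ρ v - δ q v * - 1#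
      ≈⟨ solve 5 (λ t p s w r → con (+ 1) :* (t :- con (+ 2) :* p :+ s :* r) :+ w :* r :- p :* (:- con (+ 1))
           := t :- p :- con (+ 2) :* con (+ 0) :+ (s :+ w :* con (+ 1)) :* r) refl (τ T v) (δ q v) (σ T q (fromℕ k)) w (ρ v) ⟩
    τ T v - δ q v - ι 2 * 0# + (σ T q (fromℕ k) + w * 1#) * ρ v
      ≈⟨ +-congˡ (*-congʳ (+-congˡ (*-congˡ (sym (ρ-root k))))) ⟩
    τ T v - δ q v - ι 2 * 0# + (σ T q (fromℕ k) + w * ρ (fromℕ k)) * ρ v ∎
  ∇ᵀ-σ (leaf T q w) (suc i) zero = solve 1 (λ x → con (+ 1) := con (+ 1) :- con (+ 2) :* con (+ 0) :+ x :* con (+ 0)) refl _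
  ∇ᵀ-σ {suc k} (leaf T q w) (suc i) (suc v) = trans (+-congʳ (∇ᵀ-σ T i v))
    (solve 4 (λ t p x y → t :- x :+ y :- p :* con (+ 1) := t :- p :- x :+ y) refl
      (τ T v) (δ q v) (ι 2 * δ i v) (σ T i (fromℕ k) * ρ v))

  -- The identity `Δ L = 2 D τ - 1 ŵᵀ` after differencing in the row index: `D` becomes `σ`, the
  -- constant column 1 becomes `ρ`, and the term with `κ` is again the root coordinate.
  ∇ᵀ-B : ∀ {k} (T : Tree k) e v → ∇ᵀ T (B T e) v ≈ ι 2 * σ T v e * τ T v + κ T e * ρ v - ρ e * ŵ T v
  ∇ᵀ-B vertex zero zero =
    solve 0 (con (+ 0) := con (+ 2) :* con (+ 0) :* con (+ 2) :+ con (+ 0) :* con (+ 1) :- con (+ 1) :* con (+ 0)) refl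
  ∇ᵀ-B {suc k} (leaf T q w) zero zero =
    solve 2 (λ x y → :- con (+ 2) := con (+ 2) :* (:- con (+ 1)) :* con (+ 1) :+ x :* con (+ 0) :- con (+ 0) :* y) refl
      (κ (leaf T q w) zero) w
  ∇ᵀ-B {suc k} (leaf T q w) zero (suc v) = begin
    ∇ᵀ T (attach T q w) v - δ q v * - ι 2
      ≈⟨ +-congʳ (lin (∇ᵀ-linear T) (ι 2) w (σ T q) ρ v) ⟩
    ι 2 * ∇ᵀ T (σ T q) v + w * ∇ᵀ T ρ v - δ q v * - ι 2
      ≈⟨ +-congʳ (+-cong (*-congˡ (∇ᵀ-σ T q v)) (*-congˡ (∇ᵀ-ρ T v))) ⟩
    ι 2 * (τ T v - ι 2 * δ q v + σ T q (fromℕ k) * ρ v) + w * ρ v - δ q v * - ι 2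
      ≈⟨ solve 6 (λ t p s w r x → con (+ 2) :* (t :- con (+ 2) :* p :+ s :* r) :+ w :* r :- p :* (:- con (+ 2))
           := con (+ 2) :* con (+ 1) :* (t :- p) :+ (con (+ 2) :* s :+ w :* con (+ 1)) :* r :- con (+ 0) :* x) refl
           (τ T v) (δ q v) (σ T q (fromℕ k)) w (ρ v) (ŵ T v + δ q v * w) ⟩
    ι 2 * 1# * (τ T v - δ q v) + (ι 2 * σ T q (fromℕ k) + w * 1#) * ρ v - 0# * (ŵ T v + δ q v * w)
      ≈⟨ +-congʳ (+-congˡ (*-congʳ (+-congˡ (*-congˡ (sym (ρ-root k)))))) ⟩
    ι 2 * 1# * (τ T v - δ q v) + attach T q w (fromℕ k) * ρ v - 0# * (ŵ T v + δ q v * w) ∎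
  ∇ᵀ-B {suc k} (leaf T q w) (suc e) zero =
    solve 4 (λ s w r x → con (+ 2) :* s :+ w :* r := con (+ 2) :* (s :+ w :* r) :* con (+ 1) :+ x :* con (+ 0) :- r :* w) refl
      (σ T q e) w (ρ e) (κ T e)
  ∇ᵀ-B {suc k} (leaf T q w) (suc e) (suc v) = begin
    ∇ᵀ T (B T e) v - δ q v * (ι 2 * σ T q e + w * ρ e)
      ≈⟨ +-congʳ (∇ᵀ-B T e v) ⟩
    ι 2 * σ T v e * τ T v + κ T e * ρ v - ρ e * ŵ T v - δ q v * (ι 2 * σ T q e + w * ρ e)
      ≈⟨ solve 8 (λ s t x r y p u w → con (+ 2) :* s :* t :+ x :- r :* y :- p :* (con (+ 2) :* u :+ w :* r)
           := con (+ 2) :* s :* t :+ x :- r :* (y :+ p :* w) :- con (+ 2) :* (p :* u)) refl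
           (σ T v e) (τ T v) (κ T e * ρ v) (ρ e) (ŵ T v) (δ q v) (σ T q e) w ⟩
    ι 2 * σ T v e * τ T v + κ T e * ρ v - ρ e * (ŵ T v + δ q v * w) - ι 2 * (δ q v * σ T q e)
      ≈⟨ +-congˡ (-‿cong (*-congˡ (δ-subst q v (λ i → σ T i e)))) ⟩
    ι 2 * σ T v e * τ T v + κ T e * ρ v - ρ e * (ŵ T v + δ q v * w) - ι 2 * (δ q v * σ T v e)
      ≈⟨ solve 5 (λ s t x y p → con (+ 2) :* s :* t :+ x :- y :- con (+ 2) :* (p :* s) := con (+ 2) :* s :* (t :- p) :+ x :- y) refl
           (σ T v e) (τ T v) (κ T e * ρ v) (ρ e * (ŵ T v + δ q v * w)) (δ q v) ⟩
    ι 2 * σ T v e * (τ T v - δ q v) + κ T e * ρ v - ρ e * (ŵ T v + δ q v * w) ∎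

  -- Crossing `f` changes the side of an edge `e` only if `e` is `f`, and then the sign jumps by -2;
  -- at the root itself the sign is 1. For `e` the root, `σ` is the distance to it and changes by
  -- the weight of `f`. The entry for root and root is 0, as 1 + 1 - 2.
  ∇-σ : ∀ {k} (T : Tree k) e f → ∇ T (λ v → σ T v e) f ≈ ρ f + ρ e * ω T f - ι 2 * δ e f
  ∇-σ vertex zero zero = solve 0 (con (+ 0) := con (+ 1) :+ con (+ 1) :* con (+ 1) :- con (+ 2) :* con (+ 1)) refl
  ∇-σ (leaf T q w) zero zero = solve 1 (λ w → (:- con (+ 1)) :- con (+ 1) := con (+ 0) :+ con (+ 0) :* w :- con (+ 2) :* con (+ 1)) refl w
  ∇-σ (leaf T q w) zero (suc f) = begin
    ∇ T (λ v → 1#) f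
      ≈⟨ trans (resp (∇-linear T) (λ _ → sym (+-identityʳ 1#)) f) (∇-shift T 1# (λ _ → 0#) f) ⟩
    1# * ρ f + ∇ T (λ _ → 0#) f
      ≈⟨ +-congˡ (linear-zero (∇-linear T) f) ⟩
    1# * ρ f + 0#
      ≈⟨ solve 2 (λ r x → con (+ 1) :* r :+ con (+ 0) := r :+ con (+ 0) :* x :- con (+ 2) :* con (+ 0)) refl (ρ f) (ω T f) ⟩
    ρ f + 0# * ω T f - ι 2 * 0# ∎
  ∇-σ (leaf T q w) (suc e) zero =
    solve 3 (λ s w r → s :+ w :* r :- s := con (+ 0) :+ r :* w :- con (+ 2) :* con (+ 0)) refl (σ T q e) w (ρ e)
  ∇-σ (leaf T q w) (suc e) (suc f) = ∇-σ T e f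

  -- Double counting: `κ T e + 2` is the sum, over both ends of `e`, of one plus the distance to the
  -- root, and each end collects the weight of `e` in its `ŵ`. The separate 2 is the root's own
  -- summand on the left.
  edge-sum≈vertex-sum : ∀ {k} (T : Tree k) →
    sumF (λ e → ω T e * (κ T e + ι 2)) ≈ ι 2 + sumF (λ v → (1# + σ T v (fromℕ k)) * ŵ T v)
  edge-sum≈vertex-sum vertex =
    solve 0 (con (+ 1) :* (con (+ 0) :+ con (+ 2)) :+ con (+ 0) := con (+ 2) :+ ((con (+ 1) :+ con (+ 0)) :* con (+ 0) :+ con (+ 0))) refl
  edge-sum≈vertex-sum {suc k} (leaf T q w) = begin
    w * (ι 2 * s q + w * ρ r + ι 2) + sumF (λ e → ω T e * (κ T e + ι 2))
      ≈⟨ +-congˡ (edge-sum≈vertex-sum T) ⟩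
    w * (ι 2 * s q + w * ρ r + ι 2) + (ι 2 + S)
      ≈⟨ solve 4 (λ w s r y → w :* (con (+ 2) :* s :+ w :* r :+ con (+ 2)) :+ (con (+ 2) :+ y)
           := con (+ 2) :+ ((con (+ 1) :+ (s :+ w :* r)) :* w :+ (con (+ 1) :* y :+ w :* (con (+ 1) :+ s)))) refl
           w (s q) (ρ r) S ⟩
    ι 2 + ((1# + (s q + w * ρ r)) * w + (1# * S + w * (1# + s q)))
      ≈⟨ +-congˡ (+-congˡ (+-congˡ (*-congˡ (sym (sumF-δ q (λ v → 1# + s v)))))) ⟩
    ι 2 + ((1# + (s q + w * ρ r)) * w + (1# * S + w * sumF (λ v → δ q v * (1# + s v))))
      ≈⟨ +-congˡ (+-congˡ (trans (sym (sumF-linear 1# w (λ v → (1# + s v) * ŵ T v) (λ v → δ q v * (1# + s v))))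
           (sumF-cong (λ v → solve 4 (λ s y p w → con (+ 1) :* ((con (+ 1) :+ s) :* y) :+ w :* (p :* (con (+ 1) :+ s))
               := (con (+ 1) :+ s) :* (y :+ p :* w)) refl (s v) (ŵ T v) (δ q v) w)))) ⟩
    ι 2 + ((1# + (s q + w * ρ r)) * w + sumF (λ v → (1# + s v) * (ŵ T v + δ q v * w))) ∎
    where
    r : Fin (suc k)
    r = fromℕ k
    s : Row (suc k)
    s v = σ T v r
    S : Carrier
    S = sumF (λ v → (1# + s v) * ŵ T v)

  -- Only the last row, that of the root, differs from a scalar matrix, so the matrix is triangular.
  det-root-row : ∀ {k} a (b : Row (suc k)) → det (λ e f → a * δ e f + ρ e * b f) ≈ a ^ k * (a + b (fromℕ k))
  det-root-row {zero} a b = solve 2 (λ a b → con (+ 1) :* ((a :* con (+ 1) :+ con (+ 1) :* b) :* con (+ 1)) :+ con (+ 0)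
    := con (+ 1) :* (a :+ b)) refl a (b zero)
  det-root-row {suc k} a b = begin
    det (λ e f → a * δ e f + ρ e * b f)
      ≈⟨ det-row₀ (λ e f → a * δ e f + ρ e * b f)
           (λ j → solve 2 (λ a b → a :* con (+ 0) :+ con (+ 0) :* b := con (+ 0)) refl a (b (suc j))) ⟩
    (a * 1# + 0# * b zero) * det (λ e f → a * δ e f + ρ e * b (suc f))
      ≈⟨ *-cong (solve 2 (λ a b → a :* con (+ 1) :+ con (+ 0) :* b := a) refl a (b zero)) (det-root-row a (b ∘ suc)) ⟩
    a * (a ^ k * (a + b (suc (fromℕ k))))
      ≈⟨ sym (*-assoc _ _ _) ⟩
    a * a ^ k * (a + b (suc (fromℕ k))) ∎

  1^ : ∀ k → 1# ^ k ≈ 1#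
  1^ zero    = refl
  1^ (suc k) = trans (*-identityˡ _) (1^ k)

  det-squares : ∀ {k} (T : Tree k) →
                det (λ i j → d T i j * d T i j) ≈ prodF (ω T) * (det (B T) * prodF (ω T))
  det-squares T = begin
    det Δ
      ≈⟨ sym (*-identityʳ _) ⟩
    det Δ * 1#
      ≈⟨ *-congˡ (sym (det-∇ T)) ⟩
    det Δ * det (∇ T ∘ δ)
      ≈⟨ sym (det-linear (∇-linear T) Δ) ⟩
    det (∇ T ∘ Δ)
      ≈⟨ sym (*-identityʳ _) ⟩
    det (∇ T ∘ Δ) * 1#
      ≈⟨ *-cong (sym (det-transpose (∇ T ∘ Δ))) (sym (det-∇ T)) ⟩
    det (λ f i → ∇ T (Δ i) f) * det (∇ T ∘ δ)
      ≈⟨ sym (det-linear (∇-linear T) (λ f i → ∇ T (Δ i) f)) ⟩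
    det (λ f → ∇ T (λ i → ∇ T (Δ i) f))
      ≈⟨ sym (det-transpose (λ f → ∇ T (λ i → ∇ T (Δ i) f))) ⟩
    det (λ e f → ∇ T (λ i → ∇ T (Δ i) f) e)
      ≈⟨ det-cong (λ e f → trans (∇-squares T e f) (*-assoc _ _ _)) ⟩
    det (λ e f → ω T e * (B T e f * ω T f))
      ≈⟨ det-scale-rows (ω T) (λ e f → B T e f * ω T f) ⟩
    prodF (ω T) * det (λ e f → B T e f * ω T f)
      ≈⟨ *-congˡ (det-scale-columns (ω T) (B T)) ⟩
    prodF (ω T) * (det (B T) * prodF (ω T)) ∎
    where
    Δ : Fin _ → Row _
    Δ i j = d T i j * d T i j

  -- Reduction of `B` to an arrow matrix and its determinant.

  module _ {k} (T : Tree k) (z : Row (suc k)) (zτ : ∀ v → z v * τ T v ≈ ŵ T v) where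
    private
      r : Fin (suc k)
      r = fromℕ k

    -- The cofactor of `τ T v` in column `v` of the transformed `B`; `z` lets the term with `ŵ`
    -- share that factor.
    R : Fin (suc k) → Row (suc k)
    R e v = κ T e + (ι 2 * σ T v e + - ρ e * z v)

    -- The obstacle to pulling `τ` out of the columns is the term `κ T e * ρ v` of `∇ᵀ-B`. Adding
    -- the root column to every column contributes `κ T e * (τ T v - ρ v)`, which cancels it. The
    -- root column is added to itself too, hence the determinant 2.
    det-B : det (B T) * ι 2 ≈ det R * prodF (τ T)
    det-B = begin
      det (B T) * ι 2
        ≈⟨ *-congˡ (sym det-add) ⟩
      det (B T) * det (add ∘ δ)
        ≈⟨ sym (det-linear add-linear (B T)) ⟩
      det (add ∘ B T)
        ≈⟨ sym (trans (*-congˡ (det-∇ᵀ T)) (*-identityʳ _)) ⟩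
      det (add ∘ B T) * det (∇ᵀ T ∘ δ)
        ≈⟨ sym (det-linear (∇ᵀ-linear T) (add ∘ B T)) ⟩
      det (∇ᵀ T ∘ add ∘ B T)
        ≈⟨ det-cong entry ⟩
      det (λ e v → R e v * τ T v)
        ≈⟨ det-scale-columns (τ T) R ⟩
      det R * prodF (τ T) ∎
      where
      add : Row (suc k) → Row (suc k)
      add u f = u f + u r
      add-linear : IsLinear add
      add-linear = record
        { resp = λ h f → +-cong (h f) (h r)
        ; lin  = λ a b u v f → solve 6 (λ a b x y z w → a :* x :+ b :* y :+ (a :* z :+ b :* w) := a :* (x :+ z) :+ b :* (y :+ w)) refl
                   a b (u f) (v f) (u r) (v r) }
      det-add : det (add ∘ δ) ≈ ι 2
      det-add = begin
        det (add ∘ δ)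
          ≈⟨ det-cong {M = add ∘ δ} (λ e f → +-cong (sym (*-identityˡ (δ e f))) (trans (δ-sym e r) (sym (*-identityʳ (ρ e))))) ⟩
        det {suc k} (λ e f → 1# * δ e f + ρ e * 1#)
          ≈⟨ det-root-row {k} 1# (λ _ → 1#) ⟩
        1# ^ k * (1# + 1#)
          ≈⟨ *-congʳ (1^ k) ⟩
        1# * (1# + 1#)
          ≈⟨ solve 0 (con (+ 1) :* (con (+ 1) :+ con (+ 1)) := con (+ 2)) refl ⟩
        ι 2 ∎
      entry : ∀ e v → ∇ᵀ T (add (B T e)) v ≈ R e v * τ T v
      entry e v = begin
        ∇ᵀ T (λ f → B T e f + κ T e) v
          ≈⟨ ∇ᵀ-shift T (κ T e) (B T e) v ⟩
        ∇ᵀ T (B T e) v + κ T e * (τ T v - ρ v)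
          ≈⟨ +-congʳ (∇ᵀ-B T e v) ⟩
        ι 2 * σ T v e * τ T v + κ T e * ρ v - ρ e * ŵ T v + κ T e * (τ T v - ρ v)
          ≈⟨ +-congʳ (+-congˡ (-‿cong (*-congˡ (sym (zτ v))))) ⟩
        ι 2 * σ T v e * τ T v + κ T e * ρ v - ρ e * (z v * τ T v) + κ T e * (τ T v - ρ v)
          ≈⟨ solve 6 (λ s t κ ρ r z → con (+ 2) :* s :* t :+ κ :* ρ :- r :* (z :* t) :+ κ :* (t :- ρ)
               := (κ :+ (con (+ 2) :* s :+ (:- r) :* z)) :* t) refl (σ T v e) (τ T v) (κ T e) (ρ v) (ρ e) (z v) ⟩
        R e v * τ T v ∎

    private
      a b a+ρ : Row (suc k)
      a e = κ T e + ι 2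
      b f = ι 2 * ω T f - ∇ T z f
      a+ρ e = a e + ρ e

    ∇-R : ∀ e f → ∇ T (R e) f ≈ - ι 4 * δ e f + a e * ρ f + ρ e * b f
    ∇-R e f = begin
      ∇ T (R e) f
        ≈⟨ ∇-shift T (κ T e) _ f ⟩
      κ T e * ρ f + ∇ T (ι 2 ⊙ (λ v → σ T v e) ⊕ - ρ e ⊙ z) f
        ≈⟨ +-congˡ (lin (∇-linear T) (ι 2) (- ρ e) (λ v → σ T v e) z f) ⟩
      κ T e * ρ f + (ι 2 * ∇ T (λ v → σ T v e) f + - ρ e * ∇ T z f)
        ≈⟨ +-congˡ (+-congʳ (*-congˡ (∇-σ T e f))) ⟩
      κ T e * ρ f + (ι 2 * (ρ f + ρ e * ω T f - ι 2 * δ e f) + - ρ e * ∇ T z f)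
        ≈⟨ solve 6 (λ κ p r o x n → κ :* p :+ (con (+ 2) :* (p :+ r :* o :- con (+ 2) :* x) :+ (:- r) :* n)
             := (:- con (+ 4)) :* x :+ (κ :+ con (+ 2)) :* p :+ r :* (con (+ 2) :* o :- n)) refl
             (κ T e) (ρ f) (ρ e) (ω T f) (δ e f) (∇ T z f) ⟩
      - ι 4 * δ e f + a e * ρ f + ρ e * b f ∎

    b-root : b r ≈ ι 2 - z r
    b-root = trans (+-cong (*-congˡ (ω-root T)) (-‿cong (∇-root T z)))
      (solve 1 (λ x → con (+ 2) :* con (+ 1) :- x := con (+ 2) :- x) refl (z r))

    a-root : a r ≈ ι 2
    a-root = trans (+-congʳ (κ-root T)) (+-identityˡ _)

    -- With `z` equal to `ŵ` over `τ`, this is the sum in the theorem.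
    β : Carrier
    β = sumF (λ v → ŵ T v * z v)

    -- The part with `ω` is the double count; the part with `∇ T z` is moved onto `a` by
    -- adjointness. Both contain twice the distance sum `S`, which therefore cancels and leaves `β`
    -- with root terms.
    b·a : sumF (λ e → b e * a e) ≈ ι 4 + β + ι 2 * z r
    b·a = begin
      sumF (λ e → b e * a e)
        ≈⟨ sumF-cong (λ e → solve 3 (λ o n x → (con (+ 2) :* o :- n) :* x := con (+ 2) :* (o :* x) :+ (:- con (+ 1)) :* (n :* x)) refl
             (ω T e) (∇ T z e) (a e)) ⟩
      sumF (λ e → ι 2 * (ω T e * a e) + - 1# * (∇ T z e * a e))
        ≈⟨ sumF-linear (ι 2) (- 1#) (λ e → ω T e * a e) (λ e → ∇ T z e * a e) ⟩
      ι 2 * sumF (λ e → ω T e * a e) + - 1# * sumF (λ e → ∇ T z e * a e)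
        ≈⟨ +-cong (*-congˡ (edge-sum≈vertex-sum T)) (*-congˡ (trans (∇-adjoint T z a) (sumF-cong summand))) ⟩
      ι 2 * (ι 2 + S) + - 1# * sumF (λ v → 1# * (ι 2 * ((1# + σ T v r) * ŵ T v) + - 1# * (ŵ T v * z v)) + - ι 2 * (δ r v * z v))
        ≈⟨ +-congˡ (*-congˡ (trans (sumF-linear 1# (- ι 2) (λ v → ι 2 * ((1# + σ T v r) * ŵ T v) + - 1# * (ŵ T v * z v)) (λ v → ρ v * z v))
             (+-cong (*-congˡ (sumF-linear (ι 2) (- 1#) (λ v → (1# + σ T v r) * ŵ T v) (λ v → ŵ T v * z v))) (*-congˡ (sumF-δ r z))))) ⟩
      ι 2 * (ι 2 + S) + - 1# * (1# * (ι 2 * S + - 1# * β) + - ι 2 * z r)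
        ≈⟨ solve 3 (λ s β z → con (+ 2) :* (con (+ 2) :+ s) :+ (:- con (+ 1)) :* (con (+ 1) :* (con (+ 2) :* s :+ (:- con (+ 1)) :* β) :+ (:- con (+ 2)) :* z)
             := con (+ 4) :+ β :+ con (+ 2) :* z) refl S β (z r) ⟩
      ι 4 + β + ι 2 * z r ∎
      where
      S : Carrier
      S = sumF (λ v → (1# + σ T v r) * ŵ T v)
      summand : ∀ v → z v * ∇ᵀ T a v ≈ 1# * (ι 2 * ((1# + σ T v r) * ŵ T v) + - 1# * (ŵ T v * z v)) + - ι 2 * (ρ v * z v)
      summand v = begin
        z v * ∇ᵀ T (λ e → κ T e + ι 2) v
          ≈⟨ *-congˡ (∇ᵀ-shift T (ι 2) (κ T) v) ⟩
        z v * (∇ᵀ T (κ T) v + ι 2 * (τ T v - ρ v))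
          -- By symmetry the root column `κ` is also the root row of `B`, to which `∇ᵀ-B` applies.
          ≈⟨ *-congˡ (+-congʳ (trans (resp (∇ᵀ-linear T) (λ e → B-sym T e r) v) (∇ᵀ-B T r v))) ⟩
        z v * (ι 2 * σ T v r * τ T v + κ T r * ρ v - ρ r * ŵ T v + ι 2 * (τ T v - ρ v))
          ≈⟨ *-congˡ (+-congʳ (+-cong (+-congˡ (*-congʳ (κ-root T))) (-‿cong (*-congʳ (ρ-root k))))) ⟩
        z v * (ι 2 * σ T v r * τ T v + 0# * ρ v - 1# * ŵ T v + ι 2 * (τ T v - ρ v))
          ≈⟨ solve 5 (λ z s t p y → z :* (con (+ 2) :* s :* t :+ con (+ 0) :* p :- con (+ 1) :* y :+ con (+ 2) :* (t :- p))
               := con (+ 1) :* (con (+ 2) :* ((con (+ 1) :+ s) :* (z :* t)) :+ (:- con (+ 1)) :* (y :* z)) :+ (:- con (+ 2)) :* (p :* z)) refl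
               (z v) (σ T v r) (τ T v) (ρ v) (ŵ T v) ⟩
        1# * (ι 2 * ((1# + σ T v r) * (z v * τ T v)) + - 1# * (ŵ T v * z v)) + - ι 2 * (ρ v * z v)
          ≈⟨ +-congʳ (*-congˡ (+-congʳ (*-congˡ (*-congˡ (zτ v))))) ⟩
        1# * (ι 2 * ((1# + σ T v r) * ŵ T v) + - 1# * (ŵ T v * z v)) + - ι 2 * (ρ v * z v) ∎

    -- The operation `add` is chosen to clear the column part `a` of the arrow. The row `a+ρ` agrees
    -- with `a` off the root and is 3 at the root, so the coefficient of `a e` in the root column
    -- becomes 1 - 4 + 3 = 0. The operation has determinant 1 + 3 = 4, and a single filled root row
    -- remains.
    det-R : det R * ι 4 ≈ (- ι 4) ^ k * β
    det-R = begin
      det R * ι 4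
        ≈⟨ *-cong (sym (trans (*-congˡ (det-∇ T)) (*-identityʳ _))) (sym det-add) ⟩
      det R * det (∇ T ∘ δ) * det (add ∘ δ)
        ≈⟨ *-congʳ (sym (det-linear (∇-linear T) R)) ⟩
      det (∇ T ∘ R) * det (add ∘ δ)
        ≈⟨ sym (det-linear add-linear (∇ T ∘ R)) ⟩
      det (add ∘ ∇ T ∘ R)
        ≈⟨ det-cong entry ⟩
      det (λ e f → - ι 4 * δ e f + ρ e * (b f + (sumF (λ i → b i * a+ρ i) - ι 4) * ρ f))
        ≈⟨ det-root-row (- ι 4) (λ f → b f + (sumF (λ i → b i * a+ρ i) - ι 4) * ρ f) ⟩
      (- ι 4) ^ k * (- ι 4 + (b r + (sumF (λ i → b i * a+ρ i) - ι 4) * ρ r))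
        ≈⟨ *-congˡ (+-congˡ (+-cong b-root (*-cong (+-congʳ b·a+ρ) (ρ-root k)))) ⟩
      (- ι 4) ^ k * (- ι 4 + ((ι 2 - z r) + (ι 4 + β + ι 2 * z r + (ι 2 - z r) - ι 4) * 1#))
        ≈⟨ *-congˡ (solve 2 (λ β z → (:- con (+ 4)) :+ ((con (+ 2) :- z) :+ (con (+ 4) :+ β :+ con (+ 2) :* z :+ (con (+ 2) :- z) :- con (+ 4)) :* con (+ 1)) := β) refl β (z r)) ⟩
      (- ι 4) ^ k * β ∎
      where
      sumF-+ : ∀ {n} (f g : Row n) → sumF (λ i → f i + g i) ≈ sumF f + sumF g
      sumF-+ f g = trans (sumF-cong (λ i → +-cong (sym (*-identityˡ (f i))) (sym (*-identityˡ (g i)))))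
        (trans (sumF-linear 1# 1# f g) (+-cong (*-identityˡ _) (*-identityˡ _)))
      b·a+ρ : sumF (λ i → b i * a+ρ i) ≈ ι 4 + β + ι 2 * z r + (ι 2 - z r)
      b·a+ρ = begin
        sumF (λ i → b i * a+ρ i)
          ≈⟨ sumF-cong (λ i → trans (distribˡ (b i) (a i) (ρ i)) (+-congˡ (*-comm (b i) (ρ i)))) ⟩
        sumF (λ i → b i * a i + ρ i * b i)
          ≈⟨ sumF-+ (λ i → b i * a i) (λ i → ρ i * b i) ⟩
        sumF (λ i → b i * a i) + sumF (λ i → ρ i * b i)
          ≈⟨ +-cong b·a (trans (sumF-δ r b) b-root) ⟩
        ι 4 + β + ι 2 * z r + (ι 2 - z r) ∎
      dot : Row (suc k) → Carrier
      dot u = sumF (λ i → u i * a+ρ i)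
      add : Row (suc k) → Row (suc k)
      add u f = u f + dot u * ρ f
      dot-linear : ∀ p q u v → dot (p ⊙ u ⊕ q ⊙ v) ≈ p * dot u + q * dot v
      dot-linear p q u v = trans
        (sumF-cong (λ i → solve 5 (λ p q x y w → (p :* x :+ q :* y) :* w := p :* (x :* w) :+ q :* (y :* w)) refl p q (u i) (v i) (a+ρ i)))
        (sumF-linear p q (λ i → u i * a+ρ i) (λ i → v i * a+ρ i))
      add-linear : IsLinear add
      add-linear = record
        { resp = λ h f → +-cong (h f) (*-congʳ (sumF-cong (λ i → *-congʳ {a+ρ i} (h i))))
        ; lin  = λ p q u v f → trans (+-congˡ (*-congʳ (dot-linear p q u v)))
            (solve 7 (λ p q x y s t w → p :* x :+ q :* y :+ (p :* s :+ q :* t) :* w := p :* (x :+ s :* w) :+ q :* (y :+ t :* w)) refl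
              p q (u f) (v f) (dot u) (dot v) (ρ f)) }
      det-add : det (add ∘ δ) ≈ ι 4
      det-add = begin
        det (add ∘ δ)
          ≈⟨ sym (det-transpose (add ∘ δ)) ⟩
        det (λ f e → δ e f + dot (δ e) * ρ f)
          ≈⟨ det-cong {N = λ f e → 1# * δ f e + ρ f * a+ρ e} (λ f e → +-cong (trans (δ-sym e f) (sym (*-identityˡ _))) (trans (*-congʳ (sumF-δ e a+ρ)) (*-comm _ _))) ⟩
        det (λ f e → 1# * δ f e + ρ f * a+ρ e)
          ≈⟨ det-root-row 1# a+ρ ⟩
        1# ^ k * (1# + (a r + ρ r))
          ≈⟨ *-cong (1^ k) (+-congˡ (+-cong a-root (ρ-root k))) ⟩
        1# * (1# + (ι 2 + 1#))
          ≈⟨ solve 0 (con (+ 1) :* (con (+ 1) :+ (con (+ 2) :+ con (+ 1))) := con (+ 4)) refl ⟩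
        ι 4 ∎
      entry : ∀ e f → add (∇ T (R e)) f ≈ - ι 4 * δ e f + ρ e * (b f + (sumF (λ i → b i * a+ρ i) - ι 4) * ρ f)
      entry e f = begin
        ∇ T (R e) f + dot (∇ T (R e)) * ρ f
          ≈⟨ +-cong (∇-R e f) (*-congʳ dot-∇R) ⟩
        - ι 4 * δ e f + a e * ρ f + ρ e * b f + (- ι 4 * (a e + ρ e) + (a e * (ι 2 + 1#) + ρ e * dot b)) * ρ f
          ≈⟨ solve 6 (λ x a p r b s → (:- con (+ 4)) :* x :+ a :* p :+ r :* b :+ ((:- con (+ 4)) :* (a :+ r) :+ (a :* (con (+ 2) :+ con (+ 1)) :+ r :* s)) :* p
               := (:- con (+ 4)) :* x :+ r :* (b :+ (s :- con (+ 4)) :* p)) refl (δ e f) (a e) (ρ f) (ρ e) (b f) (dot b) ⟩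
        - ι 4 * δ e f + ρ e * (b f + (dot b - ι 4) * ρ f) ∎
        where
        dot-∇R : dot (∇ T (R e)) ≈ - ι 4 * (a e + ρ e) + (a e * (ι 2 + 1#) + ρ e * dot b)
        dot-∇R = begin
          dot (∇ T (R e))
            ≈⟨ sumF-cong (λ i → *-congʳ {a+ρ i} (trans (∇-R e i)
                 (solve 6 (λ c x a p r b → c :* x :+ a :* p :+ r :* b := c :* x :+ con (+ 1) :* (a :* p :+ r :* b)) refl
                   (- ι 4) (δ e i) (a e) (ρ i) (ρ e) (b i)))) ⟩
          dot (- ι 4 ⊙ δ e ⊕ 1# ⊙ (a e ⊙ ρ ⊕ ρ e ⊙ b))
            ≈⟨ trans (dot-linear (- ι 4) 1# (δ e) (a e ⊙ ρ ⊕ ρ e ⊙ b)) (+-congˡ (trans (*-identityˡ _) (dot-linear (a e) (ρ e) ρ b))) ⟩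
          - ι 4 * dot (δ e) + (a e * dot ρ + ρ e * dot b)
            ≈⟨ +-cong (*-congˡ (sumF-δ e a+ρ)) (+-congʳ (*-congˡ (trans (sumF-δ r a+ρ) (+-cong a-root (ρ-root k))))) ⟩
          - ι 4 * (a e + ρ e) + (a e * (ι 2 + 1#) + ρ e * dot b) ∎

    -- The factors 2 and 4 are the determinants of the column operations in `det-B` and `det-R`.
    squared-distance-det : ι 2 * ι 4 * det (λ i j → d T i j * d T i j)
                             ≈ prodF (ω T) * prodF (ω T) * (prodF (τ T) * ((- ι 4) ^ k * β))
    squared-distance-det = begin
      ι 2 * ι 4 * det (λ i j → d T i j * d T i j)
        ≈⟨ *-congˡ (det-squares T) ⟩
      ι 2 * ι 4 * (W * (det (B T) * W))
        ≈⟨ solve 4 (λ x y w b → x :* y :* (w :* (b :* w)) := w :* w :* ((b :* x) :* y)) refl (ι 2) (ι 4) W (det (B T)) ⟩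
      W * W * (det (B T) * ι 2 * ι 4)
        ≈⟨ *-congˡ (*-congʳ det-B) ⟩
      W * W * (det R * prodF (τ T) * ι 4)
        ≈⟨ *-congˡ (solve 3 (λ r t y → r :* t :* y := t :* (r :* y)) refl (det R) (prodF (τ T)) (ι 4)) ⟩
      W * W * (prodF (τ T) * (det R * ι 4))
        ≈⟨ *-congˡ (*-congˡ det-R) ⟩
      W * W * (prodF (τ T) * ((- ι 4) ^ k * β)) ∎
      where
      W : Carrier
      W = prodF (ω T)

-- Degrees, reindexing and walks in the abstract graph.

open import Data.List using ([]; _∷_)
open import Data.List.Relation.Unary.All using ([]; _∷_)
open import Data.List.Relation.Unary.AllPairs using ([]; _∷_)

-- An auxiliary graph of loops at one vertex: there the first incidence test of `degree` computes,
-- which exposes one unfolding of its local recursion.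
loops : ∀ n k → Fin (suc k) → Fin (suc n) × Fin (suc n)
loops n k zero    = zero , zero
loops n k (suc _) = zero , zero

mutual
  -- The recursion underlying degree is a local function that cannot be named from
  -- outside Defs; unification finds it in a degree that has been unfolded once
  -- and abstracted from its arguments.
  degreeAlong : ∀ {n m} → (Fin m → Fin n × Fin n) → Fin n → ∀ {k} → (Fin k → Fin m) → ℕ
  degreeAlong ends i f = _

  degreeAlong-solution : ∀ n k → Graph.degree (loops n k) zero ≡ Graph.degree (loops n k) zero
  degreeAlong-solution n k with suc n | suc k | loops n k | Fin.zero {n} | (λ (x : Fin k) → Fin.suc x)
  ... | _ | _ | ends | i | f = ≡.cong suc (≡.refl {x = degreeAlong ends i f})

-- Pigeonhole: punching out a missed value would inject `Fin (suc n)` into `Fin n`.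
injective⇒permutation : ∀ {n} (f : Fin n → Fin n) → Injective _≡_ _≡_ f → Permutation n n
injective⇒permutation {n} f inj = permutation f (proj₁ ∘ preimage) (proj₂ ∘ preimage) (λ i → inj (proj₂ (preimage (f i))))
  where
  preimage : ∀ y → ∃ λ i → f i ≡ y
  preimage y with any? (λ i → f i ≟ y)
  ... | yes p = p
  ... | no ¬p = contradiction (λ i y≡fi → ¬p (i , ≡.sym y≡fi)) (unavoidable f inj y)
    where
    unavoidable : ∀ {n} (f : Fin n → Fin n) → Injective _≡_ _≡_ f → ∀ y → ¬ (∀ i → y ≢ f i)
    unavoidable {suc n} f inj y y≢f = ℕ.1+n≰n (injective⇒≤ (λ {i} {j} eq → inj (punchOut-injective (y≢f i) (y≢f j) eq)))

module Reindexing {c ℓ} (F : Field c ℓ) {n} (φ : Fin n → Fin n) (φ-injective : Injective _≡_ _≡_ φ) where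
  open Field F
  open Determinants F
  open CommutativeRing commutativeRing using
    ( setoid; refl; sym; trans; +-congˡ; *-congˡ; *-congʳ; *-identityˡ; *-identityʳ; *-assoc
    ; +-commutativeMonoid; *-commutativeMonoid )
  open SetoidReasoning setoid
  private
    module Sum = CommutativeMonoidSum +-commutativeMonoid
    module Prod = CommutativeMonoidSum *-commutativeMonoid

    sumF≈sum : ∀ {k} (f : Fin k → Carrier) → sumF f ≈ Sum.sum f
    sumF≈sum {zero}  f = refl
    sumF≈sum {suc k} f = +-congˡ (sumF≈sum (f ∘ suc))

    prodF≈sum : ∀ {k} (f : Fin k → Carrier) → prodF f ≈ Prod.sum f
    prodF≈sum {zero}  f = refl
    prodF≈sum {suc k} f = *-congˡ (prodF≈sum (f ∘ suc))

    π : Permutation n n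
    π = injective⇒permutation φ φ-injective

  sumF-reindex : ∀ f → sumF (f ∘ φ) ≈ sumF f
  sumF-reindex f = trans (sumF≈sum (f ∘ φ)) (trans (sym (Sum.sum-permute f π)) (sym (sumF≈sum f)))

  prodF-reindex : ∀ f → prodF (f ∘ φ) ≈ prodF f
  prodF-reindex f = trans (prodF≈sum (f ∘ φ)) (trans (sym (Prod.sum-permute f π)) (sym (prodF≈sum f)))

  private
    reindex : Row n → Row n
    reindex = _∘ φ

    ε : Carrier
    ε = det (reindex ∘ δ)

    reindex-linear : IsLinear reindex
    reindex-linear = record { resp = λ h → h ∘ φ ; lin = λ _ _ _ _ _ → refl }

    det-reindex-ε : ∀ M → det (λ i j → M (φ i) (φ j)) ≈ det M * (ε * ε)
    det-reindex-ε M = begin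
      det (λ i j → M (φ i) (φ j))     ≈⟨ det-linear reindex-linear (M ∘ φ) ⟩
      det (M ∘ φ) * ε                 ≈⟨ *-congʳ (sym (det-transpose (M ∘ φ))) ⟩
      det (λ j i → M (φ i) j) * ε     ≈⟨ *-congʳ (det-linear reindex-linear (λ j i → M i j)) ⟩
      det (λ j i → M i j) * ε * ε     ≈⟨ *-congʳ (*-congʳ (det-transpose M)) ⟩
      det M * ε * ε                   ≈⟨ *-assoc _ _ _ ⟩
      det M * (ε * ε)                 ∎

    δ-φ : ∀ i j → δ (φ i) (φ j) ≈ δ i j
    δ-φ i j with i ≟ j
    ... | yes ≡.refl = trans (δ-refl (φ i)) (sym (δ-refl i))
    ... | no  i≢j    = trans (δ-≢ (i≢j ∘ φ-injective)) (sym (δ-≢ i≢j))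

    -- Simultaneous reindexing fixes the identity matrix, so `det-reindex-ε` at `δ` yields the
    -- square without computing the sign of the permutation.
    ε²≈1 : ε * ε ≈ 1#
    ε²≈1 = begin
      ε * ε                           ≈⟨ sym (*-identityˡ _) ⟩
      1# * (ε * ε)                    ≈⟨ *-congʳ (sym (det-δ n)) ⟩
      det (δ {n}) * (ε * ε)               ≈⟨ sym (det-reindex-ε δ) ⟩
      det (λ i j → δ (φ i) (φ j))     ≈⟨ det-cong δ-φ ⟩
      det (δ {n})                     ≈⟨ det-δ n ⟩
      1#                              ∎

  det-reindex : ∀ M → det (λ i j → M (φ i) (φ j)) ≈ det M
  det-reindex M = trans (det-reindex-ε M) (trans (*-congˡ ε²≈1) (*-identityʳ _))

module GraphLemmas {c ℓ} (F : CharZeroField c ℓ) {n m : ℕ} (ends : Fin m → Fin n × Fin n) (w : Fin m → CharZeroField.Carrier F) where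
  open CharZeroField F
  open Graph ends
  open Weighted F w
  open Determinants fld
  open CommutativeRing commutativeRing using
    ( refl; sym; trans; +-congˡ; +-congʳ; +-assoc; +-comm; +-identityˡ )

  -- The case analysis copies that of `degree` and `wdegree`, so that one `with` reduces both sides;
  -- the argument `a` covers counting as well as weighing.
  χ : Fin m → Fin n → Carrier → Carrier
  χ e i a with proj₁ (ends e) ≟ i | proj₂ (ends e) ≟ i
  ... | no _ | no _ = 0#
  ... | _    | _    = a

  χ-incident : ∀ {e i} a → incident i e → χ e i a ≈ a
  χ-incident {e} {i} a inc with proj₁ (ends e) ≟ i | proj₂ (ends e) ≟ i
  ... | no ¬p | no ¬q = contradiction inc [ ¬p , ¬q ]
  ... | no _  | yes _ = refl
  ... | yes _ | _     = refl

  χ-not-incident : ∀ {e i} a → ¬ incident i e → χ e i a ≈ 0#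
  χ-not-incident {e} {i} a ¬inc with proj₁ (ends e) ≟ i | proj₂ (ends e) ≟ i
  ... | no _  | no _  = refl
  ... | no _  | yes q = contradiction (inj₂ q) ¬inc
  ... | yes p | _     = contradiction (inj₁ p) ¬inc

  degreeAlong-χ : ∀ i {k} (f : Fin k → Fin m) → ι (degreeAlong ends i f) ≈ sumF (λ e → χ (f e) i 1#)
  degreeAlong-χ i {zero}  f = refl
  degreeAlong-χ i {suc k} f with proj₁ (ends (f zero)) ≟ i | proj₂ (ends (f zero)) ≟ i
  ... | no _  | no _  = trans (degreeAlong-χ i (f ∘ suc)) (sym (+-identityˡ _))
  ... | no _  | yes _ = +-congˡ (degreeAlong-χ i (f ∘ suc))
  ... | yes _ | _     = +-congˡ (degreeAlong-χ i (f ∘ suc))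

  degree-χ : ∀ i → ι (degree i) ≈ sumF (λ e → χ e i 1#)
  degree-χ i = degreeAlong-χ i (λ e → e)

  mutual
    -- The summand of `wdegree` is a local function; unification with the body of `wdegree` gives it
    -- a name.
    incidentWeight : Fin n → Fin m → Carrier
    incidentWeight i e = _

    wdegree-incidentWeight : ∀ i → wdegree i ≡ sumF (incidentWeight i)
    wdegree-incidentWeight i = ≡.refl

  wdegree-χ : ∀ i → wdegree i ≈ sumF (λ e → χ e i (w e))
  wdegree-χ i = sumF-cong incidentWeight-χ
    where
    incidentWeight-χ : ∀ e → incidentWeight i e ≈ χ e i (w e)
    incidentWeight-χ e with proj₁ (ends e) ≟ i | proj₂ (ends e) ≟ i
    ... | no _  | no _  = refl
    ... | no _  | yes _ = refl
    ... | yes _ | _     = refl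

  -- Uniqueness in `IsTree` speaks of edge lists only; this transfers it to distances.
  weight-edgesOf : ∀ {i j k l} (p : Walk i j) (q : Walk k l) → edgesOf p ≡ edgesOf q → weight p ≡ weight q
  weight-edgesOf []           []           _  = ≡.refl
  weight-edgesOf (step e _ p) (step f _ q) eq with ∷-injective eq
  ... | ≡.refl , eq′ = ≡.cong (λ x → w e + x) (weight-edgesOf p q eq′)

  snoc : ∀ {i k j} → Walk i k → (e : Fin m) → Joins e k j → Walk i j
  snoc []            e h = step e h []
  snoc (step e′ g p) e h = step e′ g (snoc p e h)

  vertices-snoc : ∀ {i k j} (p : Walk i k) e (h : Joins e k j) → vertices (snoc p e h) ≡ vertices p List.∷ʳ j
  vertices-snoc []                e h = ≡.refl
  vertices-snoc (step {i} e′ g p) e h = ≡.cong (i ∷_) (vertices-snoc p e h)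

  weight-snoc : ∀ {i k j} (p : Walk i k) e (h : Joins e k j) → weight (snoc p e h) ≈ w e + weight p
  weight-snoc []            e h = refl
  weight-snoc (step e′ g p) e h = trans (+-congˡ (weight-snoc p e h))
    (trans (sym (+-assoc _ _ _)) (trans (+-congʳ (+-comm _ _)) (+-assoc _ _ _)))

unique-∷ʳ : ∀ {a} {A : Set a} {xs : List A} {x} → All (_≢ x) xs → Unique xs → Unique (xs List.∷ʳ x)
unique-∷ʳ []       []       = [] ∷ []
unique-∷ʳ (h ∷ hs) (u ∷ us) = All.∷ʳ⁺ u h ∷ unique-∷ʳ hs us

-- Growing an embedded tree until it spans the graph.

module Exploration {c ℓ} (F : CharZeroField c ℓ) (m : ℕ) (ends : Fin m → Fin (suc m) × Fin (suc m))
                   (w : Fin m → CharZeroField.Carrier F) where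
  open CharZeroField F
  open Graph ends
  open Weighted F w using (weight)
  open Determinants fld
  open LeafExtensions fld
  open GraphLemmas F ends w
  open CommutativeRing commutativeRing using
    ( setoid; refl; sym; trans; +-cong; +-congˡ; +-congʳ; *-congˡ; *-congʳ; -‿cong; +-comm
    ; +-identityʳ; *-identityˡ; zeroˡ )
  open IntegerSolver commutativeRing
  open SetoidReasoning setoid

  -- Degrees and weights are counted along the embedded edges only and match those of the graph once
  -- `ψ` is onto. Paths are required to stay among visited vertices, so that prolonging one to a new
  -- vertex keeps it free of repetitions.
  record SubtreeEmbedding (k : ℕ) : Set (c ⊔ ℓ) where
    field
      tree : Tree k
      φ    : Fin (suc k) → Fin (suc m)
      ψ    : Fin k → Fin m

    Visited : Fin (suc m) → Set
    Visited x = ∃ λ i → φ i ≡ x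

    field
      φ-injective  : Injective _≡_ _≡_ φ
      ψ-injective  : Injective _≡_ _≡_ ψ
      ends-visited : ∀ e → Visited (proj₁ (ends (ψ e))) × Visited (proj₂ (ends (ψ e)))
      visited-path : ∀ i j → Σ (Walk (φ i) (φ j)) λ p → Unique (vertices p) × All Visited (vertices p) × weight p ≈ d tree i j
      τ-χ          : ∀ v → τ tree v ≈ ι 2 - sumF (λ e → χ (ψ e) (φ v) 1#)
      ŵ-χ          : ∀ v → ŵ tree v ≈ sumF (λ e → χ (ψ e) (φ v) (w (ψ e)))
      ω-ψ          : prodF (ω tree) ≈ prodF (w ∘ ψ)

  single-vertex : SubtreeEmbedding 0
  single-vertex = record
    { tree         = vertex
    ; φ            = λ _ → zero
    ; ψ            = λ ()
    ; φ-injective  = λ { {zero} {zero} _ → ≡.refl }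
    ; ψ-injective  = λ { {()} }
    ; ends-visited = λ ()
    ; visited-path = λ _ _ → [] , ([] ∷ []) , ((zero , ≡.refl) ∷ []) , refl
    ; τ-χ          = λ _ → solve 0 (con (+ 2) := con (+ 2) :- con (+ 0)) refl
    ; ŵ-χ          = λ _ → refl
    ; ω-ψ          = *-identityˡ _
    }

  module _ {k} (S : SubtreeEmbedding k) where
    open SubtreeEmbedding S

    -- Embedded edges have both ends visited, so none of them meets `x`: therefore `e` is new and
    -- `x` is a leaf.
    extend : ∀ {x} q e → ¬ Visited x → Joins e x (φ q) → SubtreeEmbedding (suc k)
    extend {x} q e ¬x joins = record
      { tree         = leaf tree q (w e)
      ; φ            = φ′
      ; ψ            = ψ′
      ; φ-injective  = λ { {zero}  {zero}  _  → ≡.refl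
                         ; {zero}  {suc j} eq → contradiction (j , ≡.sym eq) ¬x
                         ; {suc i} {zero}  eq → contradiction (i , eq) ¬x
                         ; {suc i} {suc j} eq → ≡.cong suc (φ-injective eq) }
      ; ψ-injective  = λ { {zero}  {zero}  _  → ≡.refl
                         ; {zero}  {suc f} eq → contradiction (≡.subst (incident x) eq x-incident) (x-not-incident f)
                         ; {suc f} {zero}  eq → contradiction (≡.subst (incident x) (≡.sym eq) x-incident) (x-not-incident f)
                         ; {suc f} {suc g} eq → ≡.cong suc (ψ-injective eq) }
      ; ends-visited = λ { zero    → ends-visited₀ joins
                         ; (suc f) → visited′ (proj₁ (ends-visited f)) , visited′ (proj₂ (ends-visited f)) }
      ; visited-path = paths
      ; τ-χ          = λ { zero    → sym (trans (+-congˡ (-‿cong (leaf-sum (λ _ → 1#))))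
                                       (solve 0 (con (+ 2) :- con (+ 1) := con (+ 1)) refl))
                         ; (suc v) → begin
                             τ tree v - δ q v
                               ≈⟨ +-congʳ (τ-χ v) ⟩
                             ι 2 - sumF (λ f → χ (ψ f) (φ v) 1#) - δ q v
                               ≈⟨ solve 2 (λ s p → con (+ 2) :- s :- p := con (+ 2) :- (p :* con (+ 1) :+ s)) refl _ _ ⟩
                             ι 2 - (δ q v * 1# + sumF (λ f → χ (ψ f) (φ v) 1#))
                               ≈⟨ +-congˡ (-‿cong (+-congʳ (sym (χ-new v 1#)))) ⟩
                             ι 2 - (χ e (φ v) 1# + sumF (λ f → χ (ψ f) (φ v) 1#)) ∎ }
      ; ŵ-χ          = λ { zero    → sym (leaf-sum w)
                         ; (suc v) → trans (+-comm _ _) (+-cong (sym (χ-new v (w e))) (ŵ-χ v)) }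
      ; ω-ψ          = *-congˡ ω-ψ
      }
      where
      φ′ : Fin (suc (suc k)) → Fin (suc m)
      φ′ = x Vector.∷ φ

      ψ′ : Fin (suc k) → Fin m
      ψ′ = e Vector.∷ ψ

      Visited′ : Fin (suc m) → Set
      Visited′ y = ∃ λ i → φ′ i ≡ y

      visited′ : ∀ {y} → Visited y → Visited′ y
      visited′ (i , eq) = suc i , eq

      ends-visited₀ : Joins e x (φ q) → Visited′ (proj₁ (ends e)) × Visited′ (proj₂ (ends e))
      ends-visited₀ (inj₁ eq) = (zero , ≡.sym (≡.cong proj₁ eq)) , (suc q , ≡.sym (≡.cong proj₂ eq))
      ends-visited₀ (inj₂ eq) = (suc q , ≡.sym (≡.cong proj₁ eq)) , (zero , ≡.sym (≡.cong proj₂ eq))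

      x-incident : incident x e
      x-incident = [ inj₁ ∘ ≡.cong proj₁ , inj₂ ∘ ≡.cong proj₂ ] joins

      x-not-incident : ∀ f → ¬ incident x (ψ f)
      x-not-incident f (inj₁ eq) = ¬x (≡.subst Visited eq (proj₁ (ends-visited f)))
      x-not-incident f (inj₂ eq) = ¬x (≡.subst Visited eq (proj₂ (ends-visited f)))

      leaf-sum : ∀ (g : Fin m → Carrier) → sumF (λ f → χ (ψ′ f) x (g (ψ′ f))) ≈ g e
      leaf-sum g = trans (+-cong (χ-incident (g e) x-incident) (sumF-zero (λ f → χ-not-incident (g (ψ f)) (x-not-incident f)))) (+-identityʳ _)

      χ-new : ∀ v a → χ e (φ v) a ≈ δ q v * a
      χ-new v a with q ≟ v
      ... | yes ≡.refl = trans (χ-incident a ([ inj₂ ∘ ≡.cong proj₂ , inj₁ ∘ ≡.cong proj₁ ] joins))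
                               (sym (trans (*-congʳ (δ-refl q)) (*-identityˡ a)))
      ... | no q≢v     = trans (χ-not-incident a ([ not₁ joins , not₂ joins ])) (sym (trans (*-congʳ (δ-≢ q≢v)) (zeroˡ a)))
        where
        not₁ : Joins e x (φ q) → ¬ (proj₁ (ends e) ≡ φ v)
        not₁ (inj₁ j) h = ¬x (v , ≡.trans (≡.sym h) (≡.cong proj₁ j))
        not₁ (inj₂ j) h = q≢v (φ-injective (≡.trans (≡.sym (≡.cong proj₁ j)) h))
        not₂ : Joins e x (φ q) → ¬ (proj₂ (ends e) ≡ φ v)
        not₂ (inj₁ j) h = q≢v (φ-injective (≡.trans (≡.sym (≡.cong proj₂ j)) h))
        not₂ (inj₂ j) h = ¬x (v , ≡.trans (≡.sym h) (≡.cong proj₂ j))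

      joins-sym : Joins e (φ q) x
      joins-sym = [ inj₂ , inj₁ ] joins

      x≢ : ∀ {y} → Visited y → x ≢ y
      x≢ vis ≡.refl = ¬x vis

      paths : ∀ i j → Σ (Walk (φ′ i) (φ′ j)) λ p → Unique (vertices p) × All Visited′ (vertices p) × weight p ≈ d (leaf tree q (w e)) i j
      paths zero zero = [] , ([] ∷ []) , ((zero , ≡.refl) ∷ []) , refl
      paths zero (suc j) with visited-path q j
      ... | p , unique , visited , weight-p =
        step e joins p , (All.map x≢ visited ∷ unique) , ((zero , ≡.refl) ∷ All.map visited′ visited) , +-congˡ weight-p
      paths (suc i) zero with visited-path i q
      ... | p , unique , visited , weight-p =
        snoc p e joins-sym
        , ≡.subst Unique (≡.sym (vertices-snoc p e joins-sym)) (unique-∷ʳ (All.map (λ vis → x≢ vis ∘ ≡.sym) visited) unique)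
        , ≡.subst (All Visited′) (≡.sym (vertices-snoc p e joins-sym)) (All.∷ʳ⁺ (All.map visited′ visited) (zero , ≡.refl))
        , trans (weight-snoc p e joins-sym) (+-congˡ (trans weight-p (d-sym tree i q)))
      paths (suc i) (suc j) with visited-path i j
      ... | p , unique , visited , weight-p = p , unique , All.map visited′ visited , weight-p

    unvisited : k ℕ.< m → ∃ λ x → ¬ Visited x
    unvisited k<m = ¬∀⟶∃¬ (suc m) Visited (λ x → any? (λ i → φ i ≟ x)) λ all →
      ℕ.<⇒≱ (ℕ.s≤s k<m) (injective⇒≤ (λ {x} {y} eq →
        ≡.trans (≡.sym (proj₂ (all x))) (≡.trans (≡.cong φ eq) (proj₂ (all y)))))

    -- The first step of the walk that enters the visited set provides the edge to attach.
    crossing : ∀ {x y} → Walk x y → ¬ Visited x → Visited y → ∃ λ z → ∃ λ q → ∃ λ e → ¬ Visited z × Joins e z (φ q)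
    crossing []                   ¬x y = contradiction y ¬x
    crossing (step {k = z} e h p) ¬x y with any? (λ i → φ i ≟ z)
    ... | yes (q , ≡.refl) = _ , q , e , ¬x , h
    ... | no ¬z            = crossing p ¬z y

    grow : IsTree → k ℕ.< m → SubtreeEmbedding (suc k)
    grow T k<m with unvisited k<m
    ... | x , ¬x with crossing (proj₁ (IsTree.path T x (φ zero))) ¬x (zero , ≡.refl)
    ...   | _ , q , e , ¬z , joins = extend q e ¬z joins

  explore : IsTree → ∀ k → k ℕ.≤ m → SubtreeEmbedding k
  explore T zero    _   = single-vertex
  explore T (suc k) k<m = grow (explore T k (ℕ.<⇒≤ k<m)) T k<m

-- Numerals and constants in characteristic zero.

module _ {c ℓ} (F : CharZeroField c ℓ) where
  open CharZeroField F
  open CommutativeRing commutativeRing using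
    ( setoid; refl; sym; trans; ring; *-congˡ; *-congʳ; +-congʳ; *-identityʳ; *-cong )
  open RingProperties ring using (+-cancelˡ)
  open IntegerSolver commutativeRing
  open SetoidReasoning setoid

  ι-injective : ∀ a b → ι a ≈ ι b → a ≡ b
  ι-injective zero    zero    _ = ≡.refl
  ι-injective zero    (suc b) h = contradiction (sym h) (charZero b)
  ι-injective (suc a) zero    h = contradiction h (charZero a)
  ι-injective (suc a) (suc b) h = ≡.cong suc (ι-injective a b (+-cancelˡ 1# _ _ h))

  -- Turns the hypothesis that a degree is not 2 into invertibility of `τ`.
  ι-≉ : ∀ {a b} → a ≢ b → ¬ (ι a - ι b ≈ 0#)
  ι-≉ {a} {b} a≢b h = a≢b (ι-injective a b (begin
    ι a               ≈⟨ solve 2 (λ x y → x := x :- y :+ y) refl (ι a) (ι b) ⟩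
    ι a - ι b + ι b   ≈⟨ +-congʳ h ⟩
    0# + ι b          ≈⟨ solve 1 (λ y → con (+ 0) :+ y := y) refl (ι b) ⟩
    ι b               ∎))

  ^-neg : ∀ x k → (- x) ^ k ≈ (- 1#) ^ k * x ^ k
  ^-neg x zero    = sym (*-identityʳ 1#)
  ^-neg x (suc k) = trans (*-congˡ (^-neg x k))
    (solve 3 (λ x s y → (:- x) :* (s :* y) := (:- con (+ 1)) :* s :* (x :* y)) refl x ((- 1#) ^ k) (x ^ k))

  -- The power `4^(n-2)` is expressed as `4^n` over 16, which makes sense for one vertex too.
  -- Splitting 16 as 4 times 4 frees one 4 to join the 2 on the left; the other turns `f`, used as
  -- `4^m`, into `4^n`.
  rescale : ∀ {x p q s f β} → ι 2 * ι 4 * x ≈ p * (q * (s * f * β)) →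
            x ≈ s * ((ι 4 * f) * ((ι 16) ⁻¹ * (ι 2) ⁻¹) * (q * (p * β)))
  rescale {x} {p} {q} {s} {f} {β} h = begin
    x
      ≈⟨ solve 1 (λ x → x := x :* con (+ 1) :* con (+ 1)) refl x ⟩
    x * 1# * 1#
      ≈⟨ *-cong (*-congˡ (sym (inverseʳ (ι 16) (charZero 15)))) (sym (inverseʳ (ι 2) (charZero 1))) ⟩
    x * (ι 16 * ι 16 ⁻¹) * (ι 2 * ι 2 ⁻¹)
      ≈⟨ *-congʳ (*-congˡ (*-congʳ (solve 0 (con (+ 16) := con (+ 4) :* con (+ 4)) refl))) ⟩
    x * (ι 4 * ι 4 * ι 16 ⁻¹) * (ι 2 * ι 2 ⁻¹)
      ≈⟨ solve 5 (λ x i j t u → x :* (u :* u :* i) :* (t :* j) := t :* u :* x :* (u :* (i :* j))) refl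
           x (ι 16 ⁻¹) (ι 2 ⁻¹) (ι 2) (ι 4) ⟩
    ι 2 * ι 4 * x * (ι 4 * (ι 16 ⁻¹ * ι 2 ⁻¹))
      ≈⟨ *-congʳ h ⟩
    p * (q * (s * f * β)) * (ι 4 * (ι 16 ⁻¹ * ι 2 ⁻¹))
      ≈⟨ solve 7 (λ w t s f β x c → w :* (t :* (s :* f :* β)) :* (x :* c) := s :* ((x :* f) :* c :* (t :* (w :* β)))) refl
           p q s f β (ι 4) (ι 16 ⁻¹ * ι 2 ⁻¹) ⟩
    s * ((ι 4 * f) * (ι 16 ⁻¹ * ι 2 ⁻¹) * (q * (p * β))) ∎

-- Transfer from the spanning tree back to the graph.

module SpanningEmbedding {c ℓ} (F : CharZeroField c ℓ) (m : ℕ) (ends : Fin m → Fin (suc m) × Fin (suc m))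
                         (w : Fin m → CharZeroField.Carrier F) (T : Graph.IsTree ends)
                         (degree≢2 : ∀ i → Graph.degree ends i ≢ 2)
                         (S : Exploration.SubtreeEmbedding F m ends w m) where
  open CharZeroField F
  open Graph ends
  open Weighted F w
  open Determinants fld
  open LeafExtensions fld hiding (τ)
  open GraphLemmas F ends w
  open Exploration F m ends w
  open CommutativeRing commutativeRing using
    ( setoid; refl; sym; trans; reflexive; +-congˡ; *-cong; *-congˡ; *-congʳ; -‿cong; *-identityˡ
    ; *-identityʳ; *-assoc; *-comm )
  open IntegerSolver commutativeRing
  open SetoidReasoning setoid
  open SubtreeEmbedding S
  module Vertices = Reindexing fld φ φ-injective
  module Edges = Reindexing fld ψ ψ-injective

  dist-φ : ∀ i j → d tree i j ≈ dist T (φ i) (φ j)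
  dist-φ i j with visited-path i j
  ... | p , unique-p , _ , weight-p = trans (sym weight-p)
    (reflexive (weight-edgesOf p _ (IsTree.unique T (φ i) (φ j) (p , unique-p) (IsTree.path T (φ i) (φ j)))))

  Δ-φ : ∀ i j → d tree i j * d tree i j ≈ Δ T (φ i) (φ j)
  Δ-φ i j = *-cong (dist-φ i j) (dist-φ i j)

  -- With `m` embedded edges `ψ` is a bijection, so counting along it counts all edges of the graph.
  τ-φ : ∀ v → LeafExtensions.τ fld tree v ≈ τ (φ v)
  τ-φ v = trans (τ-χ v) (+-congˡ (-‿cong (trans (Edges.sumF-reindex (λ e → χ e (φ v) 1#)) (sym (degree-χ (φ v))))))

  ŵ-φ : ∀ v → ŵ tree v ≈ wdegree (φ v)
  ŵ-φ v = trans (ŵ-χ v) (trans (Edges.sumF-reindex (λ e → χ e (φ v) (w e))) (sym (wdegree-χ (φ v))))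

  z : Row (suc m)
  z v = wdegree (φ v) * τ (φ v) ⁻¹

  zτ : ∀ v → z v * LeafExtensions.τ fld tree v ≈ ŵ tree v
  zτ v = begin
    wdegree (φ v) * τ (φ v) ⁻¹ * LeafExtensions.τ fld tree v   ≈⟨ *-congˡ (τ-φ v) ⟩
    wdegree (φ v) * τ (φ v) ⁻¹ * τ (φ v)                       ≈⟨ trans (*-assoc _ _ _) (*-congˡ (*-comm _ _)) ⟩
    wdegree (φ v) * (τ (φ v) * τ (φ v) ⁻¹)                     ≈⟨ *-congˡ (inverseʳ (τ (φ v)) (ι-≉ F (degree≢2 (φ v) ∘ ≡.sym))) ⟩
    wdegree (φ v) * 1#                                         ≈⟨ *-identityʳ _ ⟩
    wdegree (φ v)                                              ≈⟨ sym (ŵ-φ v) ⟩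
    ŵ tree v                                                   ∎

  prodF-* : ∀ {k} (f g : Fin k → Carrier) → prodF f * prodF g ≈ prodF (λ i → f i * g i)
  prodF-* {zero}  f g = *-identityˡ _
  prodF-* {suc k} f g = trans
    (solve 4 (λ a b x y → a :* x :* (b :* y) := a :* b :* (x :* y)) refl (f zero) (g zero) _ _)
    (*-congˡ (prodF-* (f ∘ suc) (g ∘ suc)))

  ω²≈w² : prodF (ω tree) * prodF (ω tree) ≈ prodF (λ e → w e * w e)
  ω²≈w² = trans (*-cong ω≈w ω≈w) (prodF-* w w)
    where
    ω≈w : prodF (ω tree) ≈ prodF w
    ω≈w = trans ω-ψ (Edges.prodF-reindex w)

  τ-product : prodF (LeafExtensions.τ fld tree) ≈ prodF τ
  τ-product = trans (prodF-cong τ-φ) (Vertices.prodF-reindex τ)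

  β-sum : sumF (λ v → ŵ tree v * z v) ≈ sumF (λ i → wdegree i * wdegree i * τ i ⁻¹)
  β-sum = trans (sumF-cong (λ v → trans (*-congʳ (ŵ-φ v)) (sym (*-assoc (wdegree (φ v)) (wdegree (φ v)) (τ (φ v) ⁻¹)))))
    (Vertices.sumF-reindex (λ i → wdegree i * wdegree i * τ i ⁻¹))

  scaled-det : ι 2 * ι 4 * det (Δ T) ≈ prodF (λ e → w e * w e) *
    (prodF τ * ((- 1#) ^ m * ι 4 ^ m * sumF (λ i → wdegree i * wdegree i * τ i ⁻¹)))
  scaled-det = begin
    ι 2 * ι 4 * det (Δ T)
      ≈⟨ *-congˡ (sym (trans (det-cong Δ-φ) (Vertices.det-reindex (Δ T)))) ⟩
    ι 2 * ι 4 * det (λ i j → d tree i j * d tree i j)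
      ≈⟨ squared-distance-det tree z zτ ⟩
    prodF (ω tree) * prodF (ω tree) * (prodF (LeafExtensions.τ fld tree) * ((- ι 4) ^ m * sumF (λ v → ŵ tree v * z v)))
      ≈⟨ *-cong ω²≈w² (*-cong τ-product (*-cong (^-neg F (ι 4) m) β-sum)) ⟩
    prodF (λ e → w e * w e) * (prodF τ * ((- 1#) ^ m * ι 4 ^ m * sumF (λ i → wdegree i * wdegree i * τ i ⁻¹))) ∎

theorem3p1 : ∀ {c ℓ} (F : CharZeroField c ℓ) (m : ℕ)
    (ends : Fin m → Fin (suc m) × Fin (suc m))
    (w : Fin m → CharZeroField.Carrier F) →
    let open CharZeroField F
        open Graph ends
        open Weighted F w
        n = suc m
    in (∀ e → ¬ (w e ≈ 0#)) →
       (T : IsTree) →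
       (∀ i → ¬ (degree i ≡ 2)) →
       det (Δ T) ≈ (((- 1#) ^ m)
                    * (((ι 4 ^ n) * ((ι 16) ⁻¹ * (ι 2) ⁻¹))
                    * (prodF τ
                    * (prodF (λ e → w e * w e)
                    * sumF (λ i → (wdegree i * wdegree i) * (τ i) ⁻¹)))))
theorem3p1 F m ends w _ T degree≢2 =
  rescale F (SpanningEmbedding.scaled-det F m ends w T degree≢2 (Exploration.explore F m ends w T m ℕ.≤-refl))
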